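{- For every two finite vertex transitive graphs $G_1$ and $G_2$, the following statements are equivalent: (1) $i(G_1\times G_2)\le \max\{a^*(G_1),a^*(G_2)\}$; (2) $a^*(G_1\times G_2)\le \max\{a^*(G_1),a^*(G_2)\}$; (3) $\chi_f(G_1\times G_2)=\min\{\chi_f(G_1),\chi_f(G_2)\}$; (4) $A(G_1+G_2)=\max\{A(G_1),A(G_2)\}$.
   Context: Tensor product $G\times H$: vertex set $V(G)\times V(H)$, $(u,v)\sim(u',v')$ iff $uu'\in E(G)$ and $vv'\in E(H)$; $G^n$ is the $n$-fold tensor power. $i(G)=\alpha(G)/|V(G)|$, $A(G)=\lim_{n\to\infty} i(G^n)$. $N(I)$ is the set of vertices with a neighbor in $I$; $a(G)=\max_I \frac{|I|}{|I|+|N(I)|}$ over nonempty independent sets $I$; $a^*(G)=a(G)$ if $a(G)\le\frac12$ and $a^*(G)=1$ otherwise. $\chi_f$ is the fractional chromatic number and $G_1+G_2$ is the disjoint union. -}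

module Defs where

open import Data.Bool using (Bool; true; false; _∧_; _∨_; not; if_then_else_)
open import Data.Bool.Properties using (∧-comm; ∧-zeroʳ)
open import Data.Nat as ℕ using (ℕ; zero; suc; _*_)
import Data.Nat.Properties as ℕP
open import Data.Fin using (Fin; remQuot; splitAt)
open import Data.Fin.Subset using (Subset)
open import Data.Vec using (Vec; []; _∷_; lookup)
open import Data.List using (List; []; _∷_; map; _++_; filter; foldr; length; allFin)
open import Data.Integer using (+_)
open import Data.Rational as ℚ using (ℚ; 0ℚ; 1ℚ; ½; _≤ᵇ_)
open import Data.Product using (_×_; _,_; proj₁; proj₂; Σ; ∃; ∃-syntax)
open import Data.Sum using (inj₁; inj₂)
open import Function.Bundles using (_↔_; Inverse)
open import Relation.Binary.PropositionalEquality using (_≡_; refl; sym; cong₂)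

record Graph : Set where
  field
    n      : ℕ
    adj    : Fin n → Fin n → Bool
    adj-sym    : ∀ u v → adj u v ≡ adj v u
    adj-irrefl : ∀ u → adj u u ≡ false
open Graph public

Nonempty : Graph → Set
Nonempty G = ℕ.NonZero (n G)

VertexTransitive : Graph → Set
VertexTransitive G =
  ∀ (u v : Fin (n G)) → Σ (Fin (n G) ↔ Fin (n G)) λ σ →
    (∀ x y → adj G (Inverse.to σ x) (Inverse.to σ y) ≡ adj G x y) ×
    Inverse.to σ u ≡ v

private
  ⊗adj : ∀ {m k} → (Fin m → Fin m → Bool) → (Fin k → Fin k → Bool) →
         Fin (m * k) → Fin (m * k) → Bool
  ⊗adj {m} {k} a b x y =
    a (proj₁ (remQuot {m} k x)) (proj₁ (remQuot {m} k y)) ∧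
    b (proj₂ (remQuot {m} k x)) (proj₂ (remQuot {m} k y))

_⊗_ : Graph → Graph → Graph
G ⊗ H = record
  { n = n G * n H
  ; adj = ⊗adj (adj G) (adj H)
  ; adj-sym = sy
  ; adj-irrefl = ir
  }
  where
  sy : ∀ x y → ⊗adj (adj G) (adj H) x y ≡ ⊗adj (adj G) (adj H) y x
  sy x y = cong₂ _∧_ (adj-sym G _ _) (adj-sym H _ _)
  ir : ∀ x → ⊗adj (adj G) (adj H) x x ≡ false
  ir x rewrite adj-irrefl G (proj₁ (remQuot {n G} (n H) x)) = refl

-- power G k = G^(k+1)  (the (k+1)-fold tensor power)
power : Graph → ℕ → Graph
power G zero    = G
power G (suc k) = G ⊗ power G k

private
  +adj : ∀ {m k} → (Fin m → Fin m → Bool) → (Fin k → Fin k → Bool) →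
         Fin (m ℕ.+ k) → Fin (m ℕ.+ k) → Bool
  +adj {m} a b x y with splitAt m x | splitAt m y
  ... | inj₁ g | inj₁ g' = a g g'
  ... | inj₂ h | inj₂ h' = b h h'
  ... | inj₁ _ | inj₂ _  = false
  ... | inj₂ _ | inj₁ _  = false

_⊕_ : Graph → Graph → Graph
G ⊕ H = record
  { n = n G ℕ.+ n H
  ; adj = +adj (adj G) (adj H)
  ; adj-sym = sy
  ; adj-irrefl = ir
  }
  where
  sy : ∀ x y → +adj (adj G) (adj H) x y ≡ +adj (adj G) (adj H) y x
  sy x y with splitAt (n G) x | splitAt (n G) y
  ... | inj₁ g | inj₁ g' = adj-sym G g g'
  ... | inj₂ h | inj₂ h' = adj-sym H h h'
  ... | inj₁ _ | inj₂ _  = refl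
  ... | inj₂ _ | inj₁ _  = refl
  ir : ∀ x → +adj (adj G) (adj H) x x ≡ false
  ir x with splitAt (n G) x
  ... | inj₁ g = adj-irrefl G g
  ... | inj₂ h = adj-irrefl H h

allSubsets : (m : ℕ) → List (Subset m)
allSubsets zero    = [] ∷ []
allSubsets (suc m) = map (true ∷_) (allSubsets m) ++ map (false ∷_) (allSubsets m)

anyL : ∀ {A : Set} → (A → Bool) → List A → Bool
anyL p = foldr (λ x b → p x ∨ b) false

allL : ∀ {A : Set} → (A → Bool) → List A → Bool
allL p = foldr (λ x b → p x ∧ b) true

countL : ∀ {A : Set} → (A → Bool) → List A → ℕ
countL p xs = length (filter (λ x → Data.Bool._≟_ (p x) true) xs)
  where import Data.Bool

card : ∀ {m} → Subset m → ℕ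
card {m} I = countL (lookup I) (allFin m)

isIndep : (G : Graph) → Subset (n G) → Bool
isIndep G I = allL (λ u → allL (λ v →
  not (lookup I u ∧ lookup I v ∧ adj G u v)) (allFin (n G))) (allFin (n G))

indepSets : (G : Graph) → List (Subset (n G))
indepSets G = filter (λ I → Data.Bool._≟_ (isIndep G I) true) (allSubsets (n G))
  where import Data.Bool

nonemptyIndepSets : (G : Graph) → List (Subset (n G))
nonemptyIndepSets G =
  filter (λ I → Data.Bool._≟_ (isIndep G I ∧ not (card I ℕ.≡ᵇ 0)) true) (allSubsets (n G))
  where import Data.Bool

nbhdCard : (G : Graph) → Subset (n G) → ℕ
nbhdCard G I = countL (λ v → anyL (λ u → lookup I u ∧ adj G u v) (allFin (n G)))
                      (allFin (n G))

-- a / d as a rational (convention: value 0 when d = 0; never used on d = 0)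
ratio : ℕ → ℕ → ℚ
ratio a zero    = 0ℚ
ratio a (suc d) = (+ a) ℚ./ suc d

maxℕ : List ℕ → ℕ
maxℕ = foldr ℕ._⊔_ 0

-- maximum of a list of (nonnegative) rationals; 0 on the empty list
maxℚ : List ℚ → ℚ
maxℚ = foldr ℚ._⊔_ 0ℚ

sumℚ : List ℚ → ℚ
sumℚ = foldr ℚ._+_ 0ℚ

α : Graph → ℕ
α G = maxℕ (map card (indepSets G))

iR : Graph → ℚ
iR G = ratio (α G) (n G)

aR : Graph → ℚ
aR G = maxℚ (map (λ I → ratio (card I) (card I ℕ.+ nbhdCard G I)) (nonemptyIndepSets G))

a* : Graph → ℚ
a* G = if aR G ≤ᵇ ½ then aR G else 1ℚ

IsFracColouring : (G : Graph) → (Subset (n G) → ℚ) → Set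
IsFracColouring G w =
  (∀ I → 0ℚ ℚ.≤ w I) ×
  (∀ v → 1ℚ ℚ.≤ sumℚ (map w (filter (λ I → Data.Bool._≟_ (lookup I v) true) (indepSets G))))
  where import Data.Bool

weight : (G : Graph) → (Subset (n G) → ℚ) → ℚ
weight G w = sumℚ (map w (indepSets G))

IsFracChromatic : Graph → ℚ → Set
IsFracChromatic G r =
  (∃[ w ] (IsFracColouring G w × weight G w ≡ r)) ×
  (∀ w → IsFracColouring G w → r ℚ.≤ weight G w)

-- lim s = lim t  (both limits exist in the situation of the paper):
-- s n - t n → 0
SameLimit : (ℕ → ℚ) → (ℕ → ℚ) → Set
SameLimit s t = ∀ (ε : ℚ) → 0ℚ ℚ.< ε →
  ∃[ N ] (∀ k → N ℕ.≤ k → ℚ.∣ s k ℚ.- t k ∣ ℚ.< ε)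

-- the sequence k ↦ i(G^(k+1)), whose limit is A(G)
iPow : Graph → ℕ → ℚ
iPow G k = iR (power G k)

{-# OPTIONS --safe #-}
module Submission where

-- If f : G → H is a uniformly random homomorphism and H is vertex transitive, then f(u)
-- is uniformly distributed for every u; averaging over f⁻¹(I) yields i(H) ≤ i(G) and,
-- for a nonempty independent set I of a vertex-transitive G, |I|/(|I|+|N(I)|) ≤ i(G).
-- Hence a*(G) = a(G) = i(G) and χ_f(G) = 1/i(G) for vertex-transitive G, so (1), (2)
-- and (3) all say that p := i(G₁ × G₂) is at most max(i(G₁), i(G₂)), the reverse
-- inequality being automatic.  For (4), i(Gⱼᵏ) = i(Gⱼ) because Gⱼᵏ and Gⱼ are
-- homomorphically equivalent, and (G₁ + G₂)ᵏ is a disjoint union of words in G₁ and G₂,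
-- each of which that uses both letters is homomorphically equivalent to G₁ × G₂; the two
-- pure words have vanishing density, so i((G₁ + G₂)ᵏ) → p.

open import Defs
open import Algebra.Bundles using (CommutativeRing)
import Algebra.Properties.Semiring.Sum as Sum
open import Data.Bool as Bool using (Bool; true; false; T; _∧_; _∨_; not; if_then_else_)
open import Data.Bool.Properties using (T-≡; T-∧; T-∨; T?)
open import Data.Empty using (⊥-elim)
open import Data.Fin
  using (Fin; zero; suc; combine; remQuot; splitAt; _↑ˡ_; _↑ʳ_; finToFun; funToFin)
open import Data.Fin.Properties as FinP
  using (*↔×; remQuot-combine; combine-remQuot; splitAt-↑ˡ; splitAt-↑ʳ; funToFin-finToFin; finToFun-funToFin)
open import Data.Fin.Subset using (Subset)
import Data.Integer as ℤ
import Data.Integer.Properties as ℤP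
open import Data.List as List using (List; []; _∷_; _++_; map; filter; allFin)
open import Data.List.Membership.Propositional using (_∈_)
open import Data.List.Membership.Propositional.Properties
  using (∈-map⁺; ∈-map⁻; ∈-++⁺ˡ; ∈-++⁺ʳ; ∈-filter⁺; ∈-filter⁻; foldr-selective; ∈-allFin)
open import Data.List.Properties using (map-cong; map-++; map-∘)
open import Data.List.Relation.Unary.Any using (here; there)
open import Data.Maybe using (Maybe; just; nothing; is-just; is-nothing; _<∣>_; fromMaybe)
open import Data.Maybe.Relation.Binary.Pointwise using (Pointwise; just; nothing)
open import Data.Nat
import Data.Nat.ListAction as ListAction
open import Data.Nat.ListAction.Properties using (sum-++)
open import Data.Nat.Properties
open import Data.Nat.Tactic.RingSolver using (solve-∀)
open import Data.Product using (Σ; ∃; _×_; _,_; proj₁; proj₂; uncurry)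
open import Data.Product.Function.NonDependent.Propositional using (_×-↔_)
open import Data.Rational as ℚ using (ℚ; 0ℚ; 1ℚ; ½)
import Data.Rational.Properties as ℚP
import Data.Rational.Solver as ℚSolver
import Data.Rational.Unnormalised as ℚᵘ
import Data.Rational.Unnormalised.Properties as ℚᵘP
open import Data.Sum using (_⊎_; inj₁; inj₂; [_,_]′)
open import Data.Unit using (tt)
open import Data.Vec using ([]; _∷_; lookup; tabulate)
open import Data.Vec.Properties using (lookup∘tabulate; ≡-dec)
open import Function using (_∘_; id; _⇔_; mk⇔; _↔_; mk↔ₛ′; Equivalence; Inverse)
open import Function.Construct.Composition using (_↔-∘_; _⇔-∘_)
open import Function.Construct.Symmetry using (↔-sym; ⇔-sym)
open import Relation.Binary.PropositionalEquality
open import Relation.Nullary using (Dec; does; yes; no; ¬_)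
open import Relation.Nullary.Decidable using (does-⇔; _→-dec_; dec-true)

open Sum +-*-semiring
  using (sum; sum-cong-≗; ∑-distrib-+; ∑-comm; sum-permute; *-distribˡ-sum; *-distribʳ-sum)

-- Counting in finite sets

-- The family of maps in an average only has to be closed under postcomposition with automorphisms
-- of the target, so the source may be any graph, or just a relation; ratios are compared in the
-- naturals with denominators cleared. That only the target must be vertex transitive shapes the
-- treatment of (4), because a power of G₁ + G₂ is in general not vertex transitive: it can be a
-- source but not a target. For the lower bound it is the source: its mixed words form a union of
-- components that maps to G₁ × G₂. For the upper bound the single words are the targets; G₁ × G₂
-- maps to every word, pure or mixed, so this bound holds without error term and only the lower one
-- loses the vanishing share. Each bound uses one direction of the homomorphic equivalence.

⟦_⟧ : Bool → ℕ
⟦ b ⟧ = if b then 1 else 0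

# : ∀ {m} → (Fin m → Bool) → ℕ
# χ = sum (⟦_⟧ ∘ χ)

T⇒⟦⟧≡1 : ∀ {b} → T b → ⟦ b ⟧ ≡ 1
T⇒⟦⟧≡1 {true} _ = refl

⟦⟧≤1 : ∀ b → ⟦ b ⟧ ≤ 1
⟦⟧≤1 true  = ≤-refl
⟦⟧≤1 false = z≤n

⟦∧⟧ : ∀ a b → ⟦ a ∧ b ⟧ ≡ ⟦ a ⟧ * ⟦ b ⟧
⟦∧⟧ true  b = sym (+-identityʳ _)
⟦∧⟧ false b = refl

sum-mono : ∀ {m} {f g : Fin m → ℕ} → (∀ i → f i ≤ g i) → sum f ≤ sum g
sum-mono {zero}  _   = z≤n
sum-mono {suc m} f≤g = +-mono-≤ (f≤g zero) (sum-mono (f≤g ∘ suc))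

sum-const : ∀ m c → sum {m} (λ _ → c) ≡ m * c
sum-const zero    c = refl
sum-const (suc m) c = cong (c +_) (sum-const m c)

term≤sum : ∀ {m} (f : Fin m → ℕ) i → f i ≤ sum f
term≤sum f zero    = m≤m+n _ _
term≤sum f (suc i) = ≤-trans (term≤sum (f ∘ suc) i) (m≤n+m _ _)

sum-+ : ∀ m {k} (f : Fin (m + k) → ℕ) →
        sum f ≡ sum (λ i → f (i ↑ˡ k)) + sum (λ j → f (m ↑ʳ j))
sum-+ zero    f = refl
sum-+ (suc m) f = trans (cong (f zero +_) (sum-+ m (f ∘ suc))) (sym (+-assoc (f zero) _ _))

sum-* : ∀ m {k} (f : Fin (m * k) → ℕ) → sum f ≡ sum (λ i → sum (λ j → f (combine {m} {k} i j)))
sum-* zero        f = refl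
sum-* (suc m) {k} f = trans (sum-+ k f) (cong (sum (λ j → f (j ↑ˡ m * k)) +_) (sum-* m (λ x → f (k ↑ʳ x))))

sum-δ : ∀ {m} (i : Fin m) (f : Fin m → ℕ) → sum (λ j → f j * ⟦ does (i FinP.≟ j) ⟧) ≡ f i
sum-δ {suc m} zero f = begin
  f zero * 1 + sum (λ j → f (suc j) * 0) ≡⟨ cong₂ _+_ (*-identityʳ (f zero)) (sum-cong-≗ (λ j → *-zeroʳ (f (suc j)))) ⟩
  f zero + sum {m} (λ j → 0)             ≡⟨ cong (f zero +_) (trans (sum-const m 0) (*-zeroʳ m)) ⟩
  f zero + 0                             ≡⟨ +-identityʳ _ ⟩
  f zero                                 ∎ where open ≡-Reasoning
sum-δ {suc m} (suc i) f = cong₂ _+_ (*-zeroʳ (f zero)) (sum-δ i (f ∘ suc))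

card≡# : ∀ {m} (p : Fin m → Bool) → countL p (allFin m) ≡ # p
card≡# p = count-tabulate p id
  where
  count-tabulate : ∀ {A : Set} {m} (p : A → Bool) (f : Fin m → A) →
                   countL p (List.tabulate f) ≡ # (p ∘ f)
  count-tabulate {m = zero}  p f = refl
  count-tabulate {m = suc m} p f with p (f zero)
  ... | true  = cong suc (count-tabulate p (f ∘ suc))
  ... | false = count-tabulate p (f ∘ suc)

allL⁻ : ∀ {A : Set} {p : A → Bool} {x} xs → T (allL p xs) → x ∈ xs → T (p x)
allL⁻ (x ∷ xs) h (here refl) = proj₁ (Equivalence.to T-∧ h)
allL⁻ (x ∷ xs) h (there x∈)  = allL⁻ xs (proj₂ (Equivalence.to T-∧ h)) x∈

allL⁺ : ∀ {A : Set} {p : A → Bool} xs → (∀ x → T (p x)) → T (allL p xs)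
allL⁺ []       h = tt
allL⁺ (x ∷ xs) h = Equivalence.from T-∧ (h x , allL⁺ xs h)

anyL⁺ : ∀ {A : Set} {p : A → Bool} {x} xs → x ∈ xs → T (p x) → T (anyL p xs)
anyL⁺ (x ∷ xs) (here refl) h = Equivalence.from T-∨ (inj₁ h)
anyL⁺ (x ∷ xs) (there x∈)  h = Equivalence.from (T-∨ {x = _}) (inj₂ (anyL⁺ xs x∈ h))

anyL⁻ : ∀ {A : Set} {p : A → Bool} xs → T (anyL p xs) → ∃ λ x → T (p x)
anyL⁻ (x ∷ xs) h with Equivalence.to T-∨ h
... | inj₁ px = x , px
... | inj₂ h′ = anyL⁻ xs h′

-- Independent sets and the independence number

∈-allSubsets : ∀ {m} (I : Subset m) → I ∈ allSubsets m
∈-allSubsets []          = here refl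
∈-allSubsets (true  ∷ I) = ∈-++⁺ˡ (∈-map⁺ (true ∷_) (∈-allSubsets I))
∈-allSubsets (false ∷ I) = ∈-++⁺ʳ _ (∈-map⁺ (false ∷_) (∈-allSubsets I))

T-not : ∀ {b} → T (not b) ⇔ (¬ T b)
T-not {true}  = mk⇔ (λ ()) (λ h → h tt)
T-not {false} = mk⇔ (λ _ ()) (λ _ → tt)

Independent : (G : Graph) → (Fin (n G) → Bool) → Set
Independent G χ = ∀ u v → T (χ u) → T (χ v) → ¬ T (adj G u v)

isIndep⇔ : ∀ G I → T (isIndep G I) ⇔ Independent G (lookup I)
isIndep⇔ G I = mk⇔
  (λ h u v Iu Iv uv → Equivalence.to T-not
     (allL⁻ (allFin (n G)) (allL⁻ (allFin (n G)) h (∈-allFin u)) (∈-allFin v))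
     (Equivalence.from T-∧ (Iu , Equivalence.from T-∧ (Iv , uv))))
  (λ h → allL⁺ (allFin (n G)) (λ u → allL⁺ (allFin (n G)) (λ v → Equivalence.from T-not
     (λ e → let Iu , e′ = Equivalence.to (T-∧ {lookup I u}) e
                Iv , uv = Equivalence.to (T-∧ {lookup I v}) e′
            in h u v Iu Iv uv))))

Independent-cong : ∀ G {χ ψ} → (∀ u → χ u ≡ ψ u) → Independent G χ → Independent G ψ
Independent-cong G e h u v ψu ψv = h u v (subst T (sym (e u)) ψu) (subst T (sym (e v)) ψv)

T⇒≡ : ∀ {b} → T b → b ≡ true
T⇒≡ = Equivalence.to T-≡

≡⇒T : ∀ {b} → b ≡ true → T b
≡⇒T = Equivalence.from T-≡

∈-indepSets⁺ : ∀ G {I} → Independent G (lookup I) → I ∈ indepSets G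
∈-indepSets⁺ G {I} h = ∈-filter⁺ (λ I → isIndep G I Bool.≟ true) (∈-allSubsets I) 
  (T⇒≡ (Equivalence.from (isIndep⇔ G I) h))

∈-indepSets⁻ : ∀ G {I} → I ∈ indepSets G → Independent G (lookup I)
∈-indepSets⁻ G {I} h = Equivalence.to (isIndep⇔ G I)
  (≡⇒T (proj₂ (∈-filter⁻ (λ I → isIndep G I Bool.≟ true) {xs = allSubsets (n G)} h)))

∈⇒≤maxℕ : ∀ {x xs} → x ∈ xs → x ≤ maxℕ xs
∈⇒≤maxℕ {xs = y ∷ ys} (here refl) = m≤m⊔n y (maxℕ ys)
∈⇒≤maxℕ {xs = y ∷ ys} (there x∈)  = ≤-trans (∈⇒≤maxℕ x∈) (m≤n⊔m y (maxℕ ys))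

card-tabulate : ∀ {m} (χ : Fin m → Bool) → card (tabulate χ) ≡ # χ
card-tabulate χ = trans (card≡# (lookup (tabulate χ))) (sum-cong-≗ (λ i → cong ⟦_⟧ (lookup∘tabulate χ i)))

card≤α : ∀ G I → Independent G (lookup I) → card I ≤ α G
card≤α G I h = ∈⇒≤maxℕ (∈-map⁺ card (∈-indepSets⁺ G {I} h))

#≤α : ∀ G {χ} → Independent G χ → # χ ≤ α G
#≤α G {χ} h = subst (_≤ α G) (card-tabulate χ)
  (card≤α G (tabulate χ) (Independent-cong G (λ u → sym (lookup∘tabulate χ u)) h))

α-attained : ∀ G → ∃ λ I → Independent G (lookup I) × card I ≡ α G
α-attained G with foldr-selective ⊔-sel 0 (map card (indepSets G))
... | inj₂ α∈ = let I , I∈ , eq = ∈-map⁻ card α∈ in I , ∈-indepSets⁻ G {I} I∈ , sym eq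
... | inj₁ α≡0 = ∅ , ∅-indep , trans (n≤0⇒n≡0 (≤-trans (card≤α G ∅ ∅-indep) (≤-reflexive α≡0))) (sym α≡0)
  where
  ∅ = tabulate (λ (_ : Fin (n G)) → false)
  ∅-indep : Independent G (lookup ∅)
  ∅-indep u v ∅u = ⊥-elim (subst T (lookup∘tabulate _ u) ∅u)

maxIndep : (G : Graph) → Fin (n G) → Bool
maxIndep G = lookup (proj₁ (α-attained G))

maxIndep-indep : ∀ G → Independent G (maxIndep G)
maxIndep-indep G = proj₁ (proj₂ (α-attained G))

#maxIndep : ∀ G → # (maxIndep G) ≡ α G
#maxIndep G = trans (sym (card≡# (maxIndep G))) (proj₂ (proj₂ (α-attained G)))

-- Averaging over homomorphisms

-- Random elements of a family of maps that is closed under composition with a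
-- transitive group: the image of every point is uniformly distributed.  Maps
-- Fin m → Fin k are enumerated by Fin (k ^ m).
module Averaging
  {m k : ℕ} {P : (Fin m → Fin k) → Set} (P? : ∀ f → Dec (P f))
  (P-resp : ∀ {f g} → (∀ u → f u ≡ g u) → P f → P g)
  (transitive : ∀ u v → Σ (Fin k ↔ Fin k) λ τ →
     (∀ f → P f ⇔ P (Inverse.to τ ∘ f)) × Inverse.to τ u ≡ v)
  where

  member : Fin (k ^ m) → ℕ
  member x = ⟦ does (P? (finToFun x)) ⟧

  size : ℕ
  size = sum member

  private
    postcompose : Fin k ↔ Fin k → Fin (k ^ m) ↔ Fin (k ^ m)
    postcompose τ = mk↔ₛ′ (after (Inverse.to τ)) (after (Inverse.from τ))
      (cancel (Inverse.to τ) (Inverse.from τ) (Inverse.strictlyInverseˡ τ))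
      (cancel (Inverse.from τ) (Inverse.to τ) (Inverse.strictlyInverseʳ τ))
      where
      after : (Fin k → Fin k) → Fin (k ^ m) → Fin (k ^ m)
      after g x = funToFin {m} (g ∘ finToFun x)
      funToFin-cong : ∀ {l} {f g : Fin l → Fin k} → (∀ i → f i ≡ g i) → funToFin f ≡ funToFin g
      funToFin-cong {zero}  f≗g = refl
      funToFin-cong {suc l} f≗g = cong₂ combine (f≗g zero) (funToFin-cong (f≗g ∘ suc))
      cancel : ∀ g h → (∀ y → g (h y) ≡ y) → ∀ x → after g (after h x) ≡ x
      cancel g h gh x = trans
        (funToFin-cong {m} (λ u → trans (cong g (finToFun-funToFin (h ∘ finToFun x) u)) (gh _)))
        (funToFin-finToFin {m} x)

    hits : Fin m → Fin k → ℕ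
    hits u v = sum (λ x → member x * ⟦ does (finToFun x u FinP.≟ v) ⟧)

    -- Postcomposition with a symmetry `τ` taking `v` to `v′` permutes the family and carries the
    -- members with value `v` at `u` onto those with value `v′`.
    hits-const : ∀ u v v′ → hits u v ≡ hits u v′
    hits-const u v v′ with transitive v v′
    ... | τ , P⇔ , refl = sym (trans (sum-permute _ (postcompose τ)) (sum-cong-≗ eq))
      where
      eq : ∀ x → member (Inverse.to (postcompose τ) x) *
                   ⟦ does (finToFun (Inverse.to (postcompose τ) x) u FinP.≟ Inverse.to τ v) ⟧
                 ≡ member x * ⟦ does (finToFun x u FinP.≟ v) ⟧
      eq x = cong₂ (λ a b → ⟦ a ⟧ * ⟦ b ⟧)
        (does-⇔ (mk⇔ (λ p → Equivalence.from (P⇔ _) (P-resp e p))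
                     (λ p → P-resp (sym ∘ e) (Equivalence.to (P⇔ _) p))) (P? _) (P? _))
        (does-⇔ (mk⇔ (λ p → trans (sym (Inverse.strictlyInverseʳ τ _))
                        (trans (cong (Inverse.from τ) (trans (sym (e u)) p)) (Inverse.strictlyInverseʳ τ v)))
                     (λ p → trans (e u) (cong (Inverse.to τ) p))) (_ FinP.≟ _) (_ FinP.≟ _))
        where
        e : ∀ u → finToFun (Inverse.to (postcompose τ) x) u ≡ Inverse.to τ (finToFun x u)
        e = finToFun-funToFin (Inverse.to τ ∘ finToFun x)

    -- The `k` equally large fibres of evaluation at `u` partition the family.
    k*hits : ∀ u v → k * hits u v ≡ size
    k*hits u v = begin
      k * hits u v
        ≡⟨ sum-const k (hits u v) ⟨
      sum {k} (λ _ → hits u v)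
        ≡⟨ sum-cong-≗ (hits-const u v) ⟩
      sum (λ v′ → hits u v′)
        ≡⟨ ∑-comm (λ v′ x → member x * ⟦ does (finToFun x u FinP.≟ v′) ⟧) ⟩
      sum (λ x → sum (λ v′ → member x * ⟦ does (finToFun x u FinP.≟ v′) ⟧))
        ≡⟨ sum-cong-≗ (λ x → sum-δ (finToFun x u) (λ _ → member x)) ⟩
      size ∎ where open ≡-Reasoning

  -- Uniformity with denominators cleared: a random member sends `u` into `χ` with probability `# χ`
  -- over `k`.
  preimages : ∀ (χ : Fin k → Bool) u →
              k * sum (λ x → member x * ⟦ χ (finToFun x u) ⟧) ≡ # χ * size
  preimages χ u = begin
    k * sum (λ x → member x * ⟦ χ (finToFun x u) ⟧)
      ≡⟨ cong (k *_) (sum-cong-≗ (λ x → cong (member x *_) (sym (sum-δ (finToFun x u) (⟦_⟧ ∘ χ))))) ⟩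
    k * sum (λ x → member x * sum (λ v → ⟦ χ v ⟧ * hit x v))
      ≡⟨ cong (k *_) (sum-cong-≗ (λ x → *-distribˡ-sum (member x) (λ v → ⟦ χ v ⟧ * hit x v))) ⟩
    k * sum (λ x → sum (λ v → member x * (⟦ χ v ⟧ * hit x v)))
      ≡⟨ cong (k *_) (∑-comm (λ x v → member x * (⟦ χ v ⟧ * hit x v))) ⟩
    k * sum (λ v → sum (λ x → member x * (⟦ χ v ⟧ * hit x v)))
      ≡⟨ *-distribˡ-sum k (λ v → sum (λ x → member x * (⟦ χ v ⟧ * hit x v))) ⟩
    sum (λ v → k * sum (λ x → member x * (⟦ χ v ⟧ * hit x v)))
      ≡⟨ sum-cong-≗ (λ v → trans (cong (k *_) (trans
           (sum-cong-≗ (λ x → swap (member x) ⟦ χ v ⟧ (hit x v)))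
           (sym (*-distribˡ-sum ⟦ χ v ⟧ (λ x → member x * hit x v)))))
           (swap k ⟦ χ v ⟧ (hits u v))) ⟩
    sum (λ v → ⟦ χ v ⟧ * (k * hits u v))
      ≡⟨ sum-cong-≗ (λ v → cong (⟦ χ v ⟧ *_) (k*hits u v)) ⟩
    sum (λ v → ⟦ χ v ⟧ * size)
      ≡⟨ *-distribʳ-sum size (⟦_⟧ ∘ χ) ⟨
    # χ * size ∎
    where
    open ≡-Reasoning
    hit : Fin (k ^ m) → Fin k → ℕ
    hit x v = ⟦ does (finToFun x u FinP.≟ v) ⟧
    swap : ∀ a b c → a * (b * c) ≡ b * (a * c)
    swap = solve-∀

  size>0 : ∀ {f} → P f → 0 < size
  size>0 {f} Pf = ≤-trans (≤-reflexive (sym eq)) (term≤sum member (funToFin f))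
    where
    eq : member (funToFin f) ≡ 1
    eq = cong ⟦_⟧ (trans (does-⇔ (mk⇔ id (λ _ → P-resp (sym ∘ finToFun-funToFin f) Pf)) (P? _) (P? _))
           (dec-true (P? (finToFun (funToFin f))) (P-resp (sym ∘ finToFun-funToFin f) Pf)))

  member-* : ∀ x {c} → (P (finToFun x) → c ≡ 1) → member x * c ≡ member x
  member-* x h with P? (finToFun x)
  ... | yes p = trans (*-identityˡ _) (h p)
  ... | no  _ = refl

  -- The `t`-weight of the preimage of `χ`, summed over all members, is computed vertex by vertex
  -- through `preimages` and bounded map by map by `b`. The witness `f₀` makes the family nonempty,
  -- so that its size cancels. The weight is 1 for plain comparisons of two graphs; elsewhere it
  -- cuts out the vertices that carry the argument.
  averaging : ∀ (t : Fin m → ℕ) (χ : Fin k → Bool) b {f₀} → P f₀ →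
              (∀ f → P f → sum (λ u → t u * ⟦ χ (f u) ⟧) ≤ b) →
              # χ * sum t ≤ b * k
  averaging t χ b P₀ bound = *-cancelʳ-≤ _ _ size ⦃ >-nonZero (size>0 P₀) ⦄ (begin
    # χ * sum t * size
      ≡⟨ rearrange (# χ) (sum t) size ⟩
    sum t * (# χ * size)
      ≡⟨ *-distribʳ-sum (# χ * size) t ⟩
    sum (λ u → t u * (# χ * size))
      ≡⟨ sum-cong-≗ (λ u → cong (t u *_) (preimages χ u)) ⟨
    sum (λ u → t u * (k * sum (λ x → member x * hit x u)))
      ≡⟨ sum-cong-≗ (λ u → trans (swap (t u) k _) (cong (k *_) (trans
           (*-distribˡ-sum (t u) (λ x → member x * hit x u)) (sum-cong-≗ (λ x → swap (t u) (member x) (hit x u)))))) ⟩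
    sum (λ u → k * sum (λ x → member x * (t u * hit x u)))
      ≡⟨ *-distribˡ-sum k (λ u → sum (λ x → member x * (t u * hit x u))) ⟨
    k * sum (λ u → sum (λ x → member x * (t u * hit x u)))
      ≡⟨ cong (k *_) (∑-comm (λ u x → member x * (t u * hit x u))) ⟩
    k * sum (λ x → sum (λ u → member x * (t u * hit x u)))
      ≡⟨ cong (k *_) (sum-cong-≗ (λ x → *-distribˡ-sum (member x) (λ u → t u * hit x u))) ⟨
    k * sum (λ x → member x * sum (λ u → t u * hit x u))
      ≤⟨ *-monoʳ-≤ k (sum-mono member-bound) ⟩
    k * sum (λ x → member x * b)
      ≡⟨ cong (k *_) (*-distribʳ-sum b member) ⟨
    k * (size * b)
      ≡⟨ final k size b ⟩
    b * k * size ∎)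
    where
    open ≤-Reasoning
    hit : Fin (k ^ m) → Fin m → ℕ
    hit x u = ⟦ χ (finToFun x u) ⟧
    rearrange : ∀ a b c → a * b * c ≡ b * (a * c)
    rearrange = solve-∀
    swap : ∀ a b c → a * (b * c) ≡ b * (a * c)
    swap = solve-∀
    final : ∀ a b c → a * (b * c) ≡ c * a * b
    final = solve-∀
    member-bound : ∀ x → member x * sum (λ u → t u * hit x u) ≤ member x * b
    member-bound x with P? (finToFun x)
    ... | yes p = *-monoʳ-≤ 1 (bound (finToFun x) p)
    ... | no  _ = z≤n

-- The source is a bare relation because `density-lower` averages over maps that respect only part
-- of the edges of a graph, and that part comes without a proof of symmetry.
IsHom : ∀ {m} (R : Fin m → Fin m → Bool) (H : Graph) → (Fin m → Fin (n H)) → Set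
IsHom R H f = ∀ u v → T (R u v) → T (adj H (f u) (f v))

isHom? : ∀ {m} (R : Fin m → Fin m → Bool) H f → Dec (IsHom R H f)
isHom? R H f = FinP.all? λ u → FinP.all? λ v → T? (R u v) →-dec T? (adj H (f u) (f v))

isHom-cong : ∀ {m} (R : Fin m → Fin m → Bool) H {f g} → (∀ u → f u ≡ g u) → IsHom R H f → IsHom R H g
isHom-cong R H f≗g h u v uv = subst₂ (λ a b → T (adj H a b)) (f≗g u) (f≗g v) (h u v uv)

isHom-transitive : ∀ {m} (R : Fin m → Fin m → Bool) H → VertexTransitive H →
  ∀ u v → Σ (Fin (n H) ↔ Fin (n H)) λ τ →
    (∀ f → IsHom R H f ⇔ IsHom R H (Inverse.to τ ∘ f)) × Inverse.to τ u ≡ v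
isHom-transitive R H vt u v with vt u v
... | τ , aut , τu≡v = τ ,
  (λ f → mk⇔ (λ h x y xy → subst T (sym (aut (f x) (f y))) (h x y xy))
             (λ h x y xy → subst T (aut (f x) (f y)) (h x y xy))) ,
  τu≡v

module HomAveraging {m} (R : Fin m → Fin m → Bool) (H : Graph) (vt : VertexTransitive H) =
  Averaging (isHom? R H) (isHom-cong R H) (isHom-transitive R H vt)

Hom : Graph → Graph → Set
Hom G H = ∃ λ f → IsHom (adj G) H f

pullback-indep : ∀ G H (h : Hom G H) {χ} → Independent H χ → Independent G (χ ∘ proj₁ h)
pullback-indep G H (f , hom) indep u v χu χv uv = indep (f u) (f v) χu χv (hom u v uv)

-- The no-homomorphism lemma of Albertson and Collins: preimages of a maximum independent set of `H`
-- are independent in `G`, so they have size at most `α G`, while on average they fill the share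
-- `iR H` of `G`.
no-hom : ∀ G H → VertexTransitive H → Hom G H → α H * n G ≤ α G * n H
no-hom G H vt (f₀ , hom₀) = subst₂ (λ a b → a * b ≤ α G * n H) (#maxIndep H)
  (trans (sum-const (n G) 1) (*-identityʳ _))
  (HomAveraging.averaging (adj G) H vt (λ _ → 1) (maxIndep H) (α G) hom₀ λ f hom →
     ≤-trans (≤-reflexive (sum-cong-≗ (λ u → *-identityˡ ⟦ maxIndep H (f u) ⟧)))
       (#≤α G (pullback-indep G H (f , hom) (maxIndep-indep H))))

-- Products and independence ratios

idHom : ∀ G → Hom G G
idHom G = id , λ _ _ → id

_∘ₕ_ : ∀ {G H K} → Hom H K → Hom G H → Hom G K
(g , hg) ∘ₕ (f , hf) = g ∘ f , λ u v uv → hg _ _ (hf u v uv)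

private
  coords : ∀ G H → Fin (n (G ⊗ H)) → Fin (n G) × Fin (n H)
  coords G H = remQuot {n G} (n H)

⊗-adj : ∀ G H {x y p q} → coords G H x ≡ p → coords G H y ≡ q →
        adj (G ⊗ H) x y ≡ adj G (proj₁ p) (proj₁ q) ∧ adj H (proj₂ p) (proj₂ q)
⊗-adj G H refl refl = refl

π₁ : ∀ G H → Hom (G ⊗ H) G
π₁ G H = proj₁ ∘ coords G H , λ _ _ uv → proj₁ (Equivalence.to T-∧ uv)

π₂ : ∀ G H → Hom (G ⊗ H) H
π₂ G H = proj₂ ∘ coords G H , λ x y uv →
  proj₂ (Equivalence.to (T-∧ {adj G (proj₁ (coords G H x)) (proj₁ (coords G H y))}) uv)

⟨_,_⟩ : ∀ {X G H} → Hom X G → Hom X H → Hom X (G ⊗ H)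
⟨_,_⟩ {X} {G} {H} (f , hf) (g , hg) = h , hom
  where
  h : Fin (n X) → Fin (n (G ⊗ H))
  h x = combine (f x) (g x)
  hom : IsHom (adj X) (G ⊗ H) h
  hom u v uv = subst T
    (sym (⊗-adj G H (remQuot-combine {n G} {n H} (f u) (g u)) (remQuot-combine {n G} {n H} (f v) (g v))))
    (Equivalence.from T-∧ (hf u v uv , hg u v uv))

ι₁ : ∀ G H → Hom G (G ⊕ H)
ι₁ G H = _↑ˡ n H , hom
  where
  hom : IsHom (adj G) (G ⊕ H) (_↑ˡ n H)
  hom u v uv rewrite splitAt-↑ˡ (n G) u (n H) | splitAt-↑ˡ (n G) v (n H) = uv

ι₂ : ∀ G H → Hom H (G ⊕ H)
ι₂ G H = n G ↑ʳ_ , hom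
  where
  hom : IsHom (adj H) (G ⊕ H) (n G ↑ʳ_)
  hom u v uv rewrite splitAt-↑ʳ (n G) (n H) u | splitAt-↑ʳ (n G) (n H) v = uv

⊗-vertexTransitive : ∀ G H → VertexTransitive G → VertexTransitive H → VertexTransitive (G ⊗ H)
⊗-vertexTransitive G H vtG vtH u v with coords G H u in eu | coords G H v in ev
... | u₁ , u₂ | v₁ , v₂ with vtG u₁ v₁ | vtH u₂ v₂
... | σ , σ-aut , σu≡v | τ , τ-aut , τu≡v = ρ , ρ-aut , ρu≡v
  where
  ρ : Fin (n (G ⊗ H)) ↔ Fin (n (G ⊗ H))
  ρ = ↔-sym *↔× ↔-∘ ((σ ×-↔ τ) ↔-∘ *↔×)
  ρ-coords : ∀ x → coords G H (Inverse.to ρ x) ≡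
             (Inverse.to σ (proj₁ (coords G H x)) , Inverse.to τ (proj₂ (coords G H x)))
  ρ-coords x = remQuot-combine {n G} {n H} _ _
  ρ-aut : ∀ x y → adj (G ⊗ H) (Inverse.to ρ x) (Inverse.to ρ y) ≡ adj (G ⊗ H) x y
  ρ-aut x y = trans (⊗-adj G H (ρ-coords x) (ρ-coords y)) (cong₂ _∧_ (σ-aut _ _) (τ-aut _ _))
  ρu≡v : Inverse.to ρ u ≡ v
  ρu≡v = begin
    Inverse.to ρ u ≡⟨ cong (λ (a , b) → combine (Inverse.to σ a) (Inverse.to τ b)) eu ⟩
    combine (Inverse.to σ u₁) (Inverse.to τ u₂) ≡⟨ cong₂ combine σu≡v τu≡v ⟩
    combine v₁ v₂ ≡⟨ cong (uncurry combine) (sym ev) ⟩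
    uncurry combine (coords G H v) ≡⟨ combine-remQuot {n G} (n H) v ⟩
    v ∎ where open ≡-Reasoning

⊗-nonempty : ∀ G H → Nonempty G → Nonempty H → Nonempty (G ⊗ H)
⊗-nonempty G H neG neH = m*n≢0 (n G) (n H) ⦃ neG ⦄ ⦃ neH ⦄

⊕-nonempty : ∀ G H → Nonempty G → Nonempty (G ⊕ H)
⊕-nonempty G H ne = >-nonZero (≤-trans (>-nonZero⁻¹ (n G) ⦃ ne ⦄) (m≤m+n (n G) (n H)))

power-vertexTransitive : ∀ G k → VertexTransitive G → VertexTransitive (power G k)
power-vertexTransitive G zero    vt = vt
power-vertexTransitive G (suc k) vt = ⊗-vertexTransitive G (power G k) vt (power-vertexTransitive G k vt)

power-nonempty : ∀ G k → Nonempty G → Nonempty (power G k)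
power-nonempty G zero    ne = ne
power-nonempty G (suc k) ne = ⊗-nonempty G (power G k) ne (power-nonempty G k ne)

diagonal : ∀ G k → Hom G (power G k)
diagonal G zero    = idHom G
diagonal G (suc k) = ⟨_,_⟩ {G} {G} {power G k} (idHom G) (diagonal G k)

power-n : ∀ G k → n (power G k) ≡ n G ^ suc k
power-n G zero    = sym (*-identityʳ (n G))
power-n G (suc k) = cong (n G *_) (power-n G k)

power→ : ∀ G k → Hom (power G k) G
power→ G zero    = idHom G
power→ G (suc k) = π₁ G (power G k)

vertex : ∀ G → Nonempty G → Fin (n G)
vertex G ne with n G
... | suc _ = zero

α>0 : ∀ G → Nonempty G → 0 < α G
α>0 G ne = ≤-trans (≤-reflexive (sym (T⇒⟦⟧≡1 {does (x FinP.≟ x)} (≡⇒T (dec-true (x FinP.≟ x) refl)))))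
  (≤-trans (term≤sum (λ u → ⟦ does (x FinP.≟ u) ⟧) x) (#≤α G singleton))
  where
  x = vertex G ne
  singleton : Independent G (λ u → does (x FinP.≟ u))
  singleton u v u∈ v∈ uv with x FinP.≟ u | x FinP.≟ v
  ... | yes refl | yes refl = subst T (adj-irrefl G x) uv

α≤n : ∀ G → α G ≤ n G
α≤n G = subst₂ _≤_ (#maxIndep G) (trans (sum-const (n G) 1) (*-identityʳ _)) (sum-mono (⟦⟧≤1 ∘ maxIndep G))

-- Neighbourhoods of independent sets

neighbour : (G : Graph) → Subset (n G) → Fin (n G) → Bool
neighbour G I v = anyL (λ u → lookup I u ∧ adj G u v) (allFin (n G))

nbhdCard≡# : ∀ G I → nbhdCard G I ≡ # (neighbour G I)
nbhdCard≡# G I = card≡# (neighbour G I)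

neighbour⁺ : ∀ G I u v → T (lookup I u) → T (adj G u v) → T (neighbour G I v)
neighbour⁺ G I u v u∈I uv = anyL⁺ (allFin (n G)) (∈-allFin u) (Equivalence.from T-∧ (u∈I , uv))

indep-neighbour : ∀ G I → Independent G (lookup I) → ∀ v → T (lookup I v) → ¬ T (neighbour G I v)
indep-neighbour G I indep v v∈I nb with anyL⁻ (allFin (n G)) nb
... | u , h = let u∈I , uv = Equivalence.to (T-∧ {lookup I u}) h in indep u v u∈I v∈I uv

card+nbhd≤n : ∀ G I → Independent G (lookup I) → card I + nbhdCard G I ≤ n G
card+nbhd≤n G I indep = begin
  card I + nbhdCard G I                             ≡⟨ cong₂ _+_ (card≡# (lookup I)) (nbhdCard≡# G I) ⟩
  # (lookup I) + # (neighbour G I)                  ≡⟨ ∑-distrib-+ (⟦_⟧ ∘ lookup I) (⟦_⟧ ∘ neighbour G I) ⟨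
  sum (λ v → ⟦ lookup I v ⟧ + ⟦ neighbour G I v ⟧)  ≤⟨ sum-mono (λ v → disjoint (lookup I v) (neighbour G I v) (indep-neighbour G I indep v)) ⟩
  sum {n G} (λ _ → 1)                               ≡⟨ trans (sum-const (n G) 1) (*-identityʳ _) ⟩
  n G                                               ∎
  where
  open ≤-Reasoning
  disjoint : ∀ a b → (T a → ¬ T b) → ⟦ a ⟧ + ⟦ b ⟧ ≤ 1
  disjoint true  true  h = ⊥-elim (h tt tt)
  disjoint true  false h = ≤-refl
  disjoint false b     h = ⟦⟧≤1 b

-- Replace the part of f⁻¹(S) inside I ∪ N(I) by I, where S is a maximum independent
-- set and f is a random endomorphism.
card*n≤α*closed-nbhd : ∀ G → VertexTransitive G → ∀ I → Independent G (lookup I) →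
                       card I * n G ≤ α G * (card I + nbhdCard G I)
card*n≤α*closed-nbhd G vt I indep rewrite card≡# (lookup I) | nbhdCard≡# G I =
  -- Adding `α G * # outside` to both sides turns the average over the vertices outside I ∪ N(I)
  -- into the claim about I ∪ N(I) itself. The truncated `∸` below is exact because `# (lookup I)`
  -- is at most `α G`.
  +-cancelˡ-≤ (α G * # outside) _ _ (begin
    α G * # outside + # (lookup I) * n G
      ≤⟨ +-monoˡ-≤ _ (subst (λ a → a * # outside ≤ (α G ∸ # (lookup I)) * n G) (#maxIndep G)
           (HomAveraging.averaging (adj G) G vt (⟦_⟧ ∘ outside) (maxIndep G) (α G ∸ # (lookup I))
              (proj₂ (idHom G)) exchange)) ⟩
    (α G ∸ # (lookup I)) * n G + # (lookup I) * n G
      ≡⟨ *-distribʳ-+ (n G) (α G ∸ # (lookup I)) _ ⟨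
    (α G ∸ # (lookup I) + # (lookup I)) * n G
      ≡⟨ cong (_* n G) (m∸n+n≡m (#≤α G indep)) ⟩
    α G * n G
      ≤⟨ *-monoʳ-≤ (α G) cover ⟩
    α G * (# outside + (# (lookup I) + # (neighbour G I)))
      ≡⟨ *-distribˡ-+ (α G) (# outside) _ ⟩
    α G * # outside + α G * (# (lookup I) + # (neighbour G I)) ∎)
  where
  open ≤-Reasoning
  outside : Fin (n G) → Bool
  outside u = not (lookup I u ∨ neighbour G I u)

  cover : n G ≤ # outside + (# (lookup I) + # (neighbour G I))
  cover = begin
    n G                   ≡⟨ trans (sum-const (n G) 1) (*-identityʳ _) ⟨
    sum {n G} (λ _ → 1)   ≤⟨ sum-mono (λ u → pointwise (lookup I u) (neighbour G I u)) ⟩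
    sum (λ u → ⟦ outside u ⟧ + (⟦ lookup I u ⟧ + ⟦ neighbour G I u ⟧))
      ≡⟨ ∑-distrib-+ (⟦_⟧ ∘ outside) (λ u → ⟦ lookup I u ⟧ + ⟦ neighbour G I u ⟧) ⟩
    # outside + sum (λ u → ⟦ lookup I u ⟧ + ⟦ neighbour G I u ⟧)
      ≡⟨ cong (# outside +_) (∑-distrib-+ (⟦_⟧ ∘ lookup I) (⟦_⟧ ∘ neighbour G I)) ⟩
    # outside + (# (lookup I) + # (neighbour G I)) ∎
    where
    pointwise : ∀ a b → 1 ≤ ⟦ not (a ∨ b) ⟧ + (⟦ a ⟧ + ⟦ b ⟧)
    pointwise true  b     = s≤s z≤n
    pointwise false true  = s≤s z≤n
    pointwise false false = s≤s z≤n

  exchange : ∀ f → IsHom (adj G) G f → sum (λ u → ⟦ outside u ⟧ * ⟦ maxIndep G (f u) ⟧) ≤ α G ∸ # (lookup I)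
  exchange f hom = m+n≤o⇒m≤o∸n _ (begin
    sum (λ u → ⟦ outside u ⟧ * ⟦ maxIndep G (f u) ⟧) + # (lookup I)
      ≡⟨ ∑-distrib-+ (λ u → ⟦ outside u ⟧ * ⟦ maxIndep G (f u) ⟧) (⟦_⟧ ∘ lookup I) ⟨
    sum (λ u → ⟦ outside u ⟧ * ⟦ maxIndep G (f u) ⟧ + ⟦ lookup I u ⟧)
      ≡⟨ sum-cong-≗ (λ u → pointwise (lookup I u) (neighbour G I u) (maxIndep G (f u))) ⟩
    # new
      ≤⟨ #≤α G new-indep ⟩
    α G ∎)
    where
    new : Fin (n G) → Bool
    new u = lookup I u ∨ (outside u ∧ maxIndep G (f u))
    pointwise : ∀ a b c → ⟦ not (a ∨ b) ⟧ * ⟦ c ⟧ + ⟦ a ⟧ ≡ ⟦ a ∨ (not (a ∨ b) ∧ c) ⟧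
    pointwise true  b     c     = refl
    pointwise false true  c     = refl
    pointwise false false true  = refl
    pointwise false false false = refl
    outside⇒¬nb : ∀ v → T (outside v ∧ maxIndep G (f v)) → ¬ T (neighbour G I v)
    outside⇒¬nb v h nb = Equivalence.to T-not (proj₁ (Equivalence.to (T-∧ {outside v}) h))
      (Equivalence.from (T-∨ {lookup I v}) (inj₂ nb))
    in-S : ∀ v → T (outside v ∧ maxIndep G (f v)) → T (maxIndep G (f v))
    in-S v h = proj₂ (Equivalence.to (T-∧ {outside v}) h)
    new-indep : Independent G new
    new-indep u v u∈ v∈ uv
      with Equivalence.to (T-∨ {lookup I u}) u∈ | Equivalence.to (T-∨ {lookup I v}) v∈
    ... | inj₁ Iu | inj₁ Iv = indep u v Iu Iv uv
    ... | inj₁ Iu | inj₂ ov = outside⇒¬nb v ov (neighbour⁺ G I u v Iu uv)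
    ... | inj₂ ou | inj₁ Iv = outside⇒¬nb u ou (neighbour⁺ G I v u Iv (subst T (adj-sym G u v) uv))
    ... | inj₂ ou | inj₂ ov = maxIndep-indep G (f u) (f v) (in-S u ou) (in-S v ov) (hom u v uv)

K₂ : Graph
K₂ = record
  { n = 2
  ; adj = λ u v → not (does (u FinP.≟ v))
  ; adj-sym = λ u v → cong not (does-⇔ (mk⇔ sym sym) (u FinP.≟ v) (v FinP.≟ u))
  ; adj-irrefl = λ u → cong not (dec-true (u FinP.≟ u) refl)
  }

edgeHom : ∀ G u v → T (adj G u v) → Hom K₂ G
edgeHom G u v uv = f , hom
  where
  f : Fin 2 → Fin (n G)
  f zero    = u
  f (suc _) = v
  hom : IsHom (adj K₂) G f
  hom zero       (suc zero) _ = uv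
  hom (suc zero) zero       _ = subst T (adj-sym G u v) uv
  hom (suc zero) (suc zero) ()

-- An edge is a homomorphism from `K₂`, whose independence ratio is 1/2; the factor `1` is `α K₂`,
-- reached by evaluation.
edge⇒2α≤n : ∀ G → VertexTransitive G → ∀ u v → T (adj G u v) → α G * 2 ≤ 1 * n G
edge⇒2α≤n G vt u v uv = no-hom K₂ G vt (edgeHom G u v uv)

edge-or-edgeless : ∀ G → (∃ λ u → ∃ λ v → T (adj G u v)) ⊎ α G ≡ n G
edge-or-edgeless G with FinP.any? (λ u → FinP.any? (λ v → T? (adj G u v)))
... | yes e  = inj₁ e
... | no  ¬e = inj₂ (≤-antisym (α≤n G)
  (subst (_≤ α G) (trans (sum-const (n G) 1) (*-identityʳ _)) (#≤α G {λ _ → true} (λ u v _ _ uv → ¬e (u , v , uv)))))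

-- The invariant a*

toℚᵘ-ratio : ∀ a d → ℚ.toℚᵘ (ratio a (suc d)) ℚᵘ.≃ ℚᵘ.mkℚᵘ (ℤ.+ a) d
toℚᵘ-ratio a d = ℚP.toℚᵘ-fromℚᵘ (ℚᵘ.mkℚᵘ (ℤ.+ a) d)

ratio-≤⁺ : ∀ a b c d .⦃ _ : NonZero b ⦄ .⦃ _ : NonZero d ⦄ → a * d ≤ c * b → ratio a b ℚ.≤ ratio c d
ratio-≤⁺ a (suc b) c (suc d) h = ℚP.toℚᵘ-cancel-≤
  (ℚᵘP.≤-respˡ-≃ (ℚᵘP.≃-sym (toℚᵘ-ratio a b)) (ℚᵘP.≤-respʳ-≃ (ℚᵘP.≃-sym (toℚᵘ-ratio c d))
    (ℚᵘ.*≤* (subst₂ ℤ._≤_ (ℤP.pos-* a (suc d)) (ℤP.pos-* c (suc b)) (ℤ.+≤+ h)))))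

ratio-≤⁻ : ∀ a b c d .⦃ _ : NonZero b ⦄ .⦃ _ : NonZero d ⦄ → ratio a b ℚ.≤ ratio c d → a * d ≤ c * b
ratio-≤⁻ a (suc b) c (suc d) h = ℤP.drop‿+≤+
  (subst₂ ℤ._≤_ (sym (ℤP.pos-* a (suc d))) (sym (ℤP.pos-* c (suc b)))
    (ℚᵘP.drop-*≤* (ℚᵘP.≤-respˡ-≃ (toℚᵘ-ratio a b) (ℚᵘP.≤-respʳ-≃ (toℚᵘ-ratio c d) (ℚP.toℚᵘ-mono-≤ h)))))

ratio-≡ : ∀ a b c d .⦃ _ : NonZero b ⦄ .⦃ _ : NonZero d ⦄ → a * d ≡ c * b → ratio a b ≡ ratio c d
ratio-≡ a b c d e = ℚP.≤-antisym (ratio-≤⁺ a b c d (≤-reflexive e)) (ratio-≤⁺ c d a b (≤-reflexive (sym e)))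

ratio-* : ∀ a b c d .⦃ _ : NonZero b ⦄ .⦃ _ : NonZero d ⦄ → ratio a b ℚ.* ratio c d ≡ ratio (a * c) (b * d)
ratio-* a (suc b) c (suc d) = ℚP.toℚᵘ-injective (begin
  ℚ.toℚᵘ (ratio a (suc b) ℚ.* ratio c (suc d))
    ≈⟨ ℚP.toℚᵘ-homo-* (ratio a (suc b)) (ratio c (suc d)) ⟩
  ℚ.toℚᵘ (ratio a (suc b)) ℚᵘ.* ℚ.toℚᵘ (ratio c (suc d))
    ≈⟨ ℚᵘP.*-cong (toℚᵘ-ratio a b) (toℚᵘ-ratio c d) ⟩
  ℚᵘ.mkℚᵘ (ℤ.+ a) b ℚᵘ.* ℚᵘ.mkℚᵘ (ℤ.+ c) d
    ≈⟨ ℚᵘ.*≡* (cong (ℤ._* ℤ.+ (suc b * suc d)) (sym (ℤP.pos-* a c))) ⟩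
  ℚᵘ.mkℚᵘ (ℤ.+ (a * c)) (d + b * suc d)
    ≈⟨ toℚᵘ-ratio (a * c) (d + b * suc d) ⟨
  ℚ.toℚᵘ (ratio (a * c) (suc b * suc d)) ∎)
  where open ℚᵘP.≃-Reasoning

ratio-+ : ∀ a c d .⦃ _ : NonZero d ⦄ → ratio a d ℚ.+ ratio c d ≡ ratio (a + c) d
ratio-+ a c (suc d) = ℚP.toℚᵘ-injective (begin
  ℚ.toℚᵘ (ratio a (suc d) ℚ.+ ratio c (suc d))
    ≈⟨ ℚP.toℚᵘ-homo-+ (ratio a (suc d)) (ratio c (suc d)) ⟩
  ℚ.toℚᵘ (ratio a (suc d)) ℚᵘ.+ ℚ.toℚᵘ (ratio c (suc d))
    ≈⟨ ℚᵘP.+-cong (toℚᵘ-ratio a d) (toℚᵘ-ratio c d) ⟩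
  ℚᵘ.mkℚᵘ (ℤ.+ a) d ℚᵘ.+ ℚᵘ.mkℚᵘ (ℤ.+ c) d
    ≈⟨ ℚᵘ.*≡* cross ⟩
  ℚᵘ.mkℚᵘ (ℤ.+ (a + c)) d
    ≈⟨ toℚᵘ-ratio (a + c) d ⟨
  ℚ.toℚᵘ (ratio (a + c) (suc d)) ∎)
  where
  open ℚᵘP.≃-Reasoning
  cross : (ℤ.+ a ℤ.* ℤ.+ suc d ℤ.+ ℤ.+ c ℤ.* ℤ.+ suc d) ℤ.* ℤ.+ suc d ≡ ℤ.+ (a + c) ℤ.* ℤ.+ (suc d * suc d)
  cross = trans (cong (ℤ._* ℤ.+ suc d) (sym (ℤP.*-distribʳ-+ (ℤ.+ suc d) (ℤ.+ a) (ℤ.+ c))))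
    (trans (ℤP.*-assoc (ℤ.+ (a + c)) (ℤ.+ suc d) (ℤ.+ suc d)) (cong (ℤ.+ (a + c) ℤ.*_) (sym (ℤP.pos-* (suc d) (suc d)))))

ratio-0 : ∀ d → ratio 0 d ≡ 0ℚ
ratio-0 zero    = refl
ratio-0 (suc d) = ratio-≡ 0 (suc d) 0 1 refl

0≤ratio : ∀ a d → 0ℚ ℚ.≤ ratio a d
0≤ratio a zero    = ℚP.≤-refl
0≤ratio a (suc d) = ratio-≤⁺ 0 1 a (suc d) z≤n

∈⇒≤maxℚ : ∀ {x xs} → x ∈ xs → x ℚ.≤ maxℚ xs
∈⇒≤maxℚ {xs = y ∷ ys} (here refl) = ℚP.p≤p⊔q y (maxℚ ys)
∈⇒≤maxℚ {xs = y ∷ ys} (there x∈)  = ℚP.≤-trans (∈⇒≤maxℚ x∈) (ℚP.p≤q⊔p y (maxℚ ys))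

maxℚ-lub : ∀ {b} xs → 0ℚ ℚ.≤ b → (∀ {x} → x ∈ xs → x ℚ.≤ b) → maxℚ xs ℚ.≤ b
maxℚ-lub []       0≤b h = 0≤b
maxℚ-lub (x ∷ xs) 0≤b h = ℚP.⊔-lub (h (here refl)) (maxℚ-lub xs 0≤b (h ∘ there))

T-not-≡ᵇ0 : ∀ {m} → T (not (m ≡ᵇ 0)) ⇔ (0 < m)
T-not-≡ᵇ0 {zero}  = mk⇔ (λ ()) (λ ())
T-not-≡ᵇ0 {suc m} = mk⇔ (λ _ → s≤s z≤n) (λ _ → tt)

∈-nonemptyIndepSets⁺ : ∀ G I → Independent G (lookup I) → 0 < card I → I ∈ nonemptyIndepSets G
∈-nonemptyIndepSets⁺ G I indep ne = ∈-filter⁺ (λ I → (isIndep G I ∧ not (card I ≡ᵇ 0)) Bool.≟ true) (∈-allSubsets I)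
  (T⇒≡ (Equivalence.from T-∧ (Equivalence.from (isIndep⇔ G I) indep , Equivalence.from T-not-≡ᵇ0 ne)))

∈-nonemptyIndepSets⁻ : ∀ G I → I ∈ nonemptyIndepSets G → Independent G (lookup I) × 0 < card I
∈-nonemptyIndepSets⁻ G I I∈ =
  let h = proj₂ (∈-filter⁻ (λ I → (isIndep G I ∧ not (card I ≡ᵇ 0)) Bool.≟ true) {xs = allSubsets (n G)} I∈)
      indep , ne = Equivalence.to (T-∧ {isIndep G I}) (≡⇒T h)
  in Equivalence.to (isIndep⇔ G I) indep , Equivalence.to T-not-≡ᵇ0 ne

-- The upper bound is the exchange inequality for each set in the maximum. The lower bound comes
-- from a maximum independent set `I`: it is disjoint from N(I), so |I| + |N(I)| is at most n.
aR≡iR : ∀ G → Nonempty G → VertexTransitive G → aR G ≡ iR G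
aR≡iR G ne vt = ℚP.≤-antisym upper lower
  where
  instance
    n≢0 : NonZero (n G)
    n≢0 = ne
  share : Subset (n G) → ℚ
  share I = ratio (card I) (card I + nbhdCard G I)
  share≤ : ∀ {x} → x ∈ map share (nonemptyIndepSets G) → x ℚ.≤ iR G
  share≤ x∈ with ∈-map⁻ share x∈
  ... | I , I∈ , refl = let indep , I≢∅ = ∈-nonemptyIndepSets⁻ G I I∈ in
    ratio-≤⁺ (card I) (card I + nbhdCard G I) (α G) (n G)
      ⦃ >-nonZero (≤-trans I≢∅ (m≤m+n _ _)) ⦄ (card*n≤α*closed-nbhd G vt I indep)
  upper : aR G ℚ.≤ iR G
  -- The bound must also dominate 0, the value at which the fold in `maxℚ` starts.
  upper = maxℚ-lub (map share (nonemptyIndepSets G)) (0≤ratio (α G) (n G)) share≤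
  lower : iR G ℚ.≤ aR G
  lower with α-attained G
  ... | I , indep , |I|≡α = ℚP.≤-trans
    (subst (λ a → ratio a (n G) ℚ.≤ share I) |I|≡α
      (ratio-≤⁺ (card I) (n G) (card I) (card I + nbhdCard G I) ⦃ n≢0 ⦄ ⦃ >-nonZero (≤-trans I≢∅ (m≤m+n _ _)) ⦄
        (*-monoʳ-≤ (card I) (card+nbhd≤n G I indep))))
    (∈⇒≤maxℚ (∈-map⁺ share (∈-nonemptyIndepSets⁺ G I indep I≢∅)))
    where
    I≢∅ : 0 < card I
    I≢∅ = subst (0 <_) (sym |I|≡α) (α>0 G ne)

-- The cut at 1/2 never changes the value: an edge forces `iR G` to be at most 1/2, and without
-- edges `iR G` is 1, the very value assigned above the cut.
a*≡iR : ∀ G → Nonempty G → VertexTransitive G → a* G ≡ iR G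
a*≡iR G ne vt rewrite aR≡iR G ne vt with edge-or-edgeless G
... | inj₁ (u , v , uv) = cong (if_then iR G else 1ℚ)
  (T⇒≡ (ℚP.≤⇒≤ᵇ (ratio-≤⁺ (α G) (n G) 1 2 ⦃ ne ⦄ (edge⇒2α≤n G vt u v uv))))
... | inj₂ α≡n = trans (cong (λ q → if q ℚ.≤ᵇ ½ then q else 1ℚ) i≡1) (sym i≡1)
  where
  i≡1 : iR G ≡ 1ℚ
  i≡1 = ratio-≡ (α G) (n G) 1 1 ⦃ ne ⦄ (trans (*-identityʳ _) (trans α≡n (sym (*-identityˡ _))))

-- The fractional chromatic number

private
  module ℚSum = Sum (CommutativeRing.semiring ℚP.+-*-commutativeRing)

  _≟ˢ_ : ∀ {m} (I J : Subset m) → Dec (I ≡ J)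
  _≟ˢ_ = ≡-dec Bool._≟_

Σₗ : ∀ {A : Set} → (A → ℕ) → List A → ℕ
Σₗ f xs = ListAction.sum (map f xs)

Σₗ-cong : ∀ {A : Set} {f g : A → ℕ} → (∀ x → f x ≡ g x) → ∀ xs → Σₗ f xs ≡ Σₗ g xs
Σₗ-cong f≗g xs = cong ListAction.sum (map-cong f≗g xs)

Σₗ-filter : ∀ {A : Set} (f : A → ℕ) (p : A → Bool) xs →
            Σₗ f (filter (λ x → p x Bool.≟ true) xs) ≡ Σₗ (λ x → ⟦ p x ⟧ * f x) xs
Σₗ-filter f p [] = refl
Σₗ-filter f p (x ∷ xs) with p x
... | true  = cong₂ _+_ (sym (*-identityˡ (f x))) (Σₗ-filter f p xs)
... | false = Σₗ-filter f p xs

Σₗ-*ˡ : ∀ {A : Set} c (f : A → ℕ) xs → Σₗ (λ x → c * f x) xs ≡ c * Σₗ f xs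
Σₗ-*ˡ c f []       = sym (*-zeroʳ c)
Σₗ-*ˡ c f (x ∷ xs) = trans (cong (c * f x +_) (Σₗ-*ˡ c f xs)) (sym (*-distribˡ-+ c (f x) _))

Σₗ-sum-comm : ∀ {A : Set} {m} (h : Fin m → A → ℕ) xs →
              Σₗ (λ a → sum (λ x → h x a)) xs ≡ sum (λ x → Σₗ (h x) xs)
Σₗ-sum-comm {m = m} h [] = sym (trans (sum-const m 0) (*-zeroʳ m))
Σₗ-sum-comm h (a ∷ as) = trans (cong (sum (λ x → h x a) +_) (Σₗ-sum-comm h as))
  (sym (∑-distrib-+ (λ x → h x a) (λ x → Σₗ (h x) as)))

δ : ∀ {m} → Subset m → Subset m → ℕ
δ J I = ⟦ does (J ≟ˢ I) ⟧

-- Of the two halves of the enumeration only the one whose first bit is that of the given subset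
-- contributes. The absence of repetitions lets a sum over `indepSets G` count each endomorphism
-- once.
Σδ-allSubsets : ∀ {m} (J : Subset m) → Σₗ (δ J) (allSubsets m) ≡ 1
Σδ-allSubsets []      = refl
Σδ-allSubsets {suc m} (b ∷ J) = begin
  Σₗ (δ (b ∷ J)) (map (true ∷_) (allSubsets m) ++ map (false ∷_) (allSubsets m))
    ≡⟨ cong ListAction.sum (map-++ (δ (b ∷ J)) (map (true ∷_) (allSubsets m)) _) ⟩
  ListAction.sum (map (δ (b ∷ J)) (map (true ∷_) (allSubsets m)) ++ map (δ (b ∷ J)) (map (false ∷_) (allSubsets m)))
    ≡⟨ sum-++ (map (δ (b ∷ J)) (map (true ∷_) (allSubsets m))) _ ⟩
  Σₗ (δ (b ∷ J)) (map (true ∷_) (allSubsets m)) + Σₗ (δ (b ∷ J)) (map (false ∷_) (allSubsets m))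
    ≡⟨ cong₂ _+_ (head-case true) (head-case false) ⟩
  ⟦ does (b Bool.≟ true) ⟧ * 1 + ⟦ does (b Bool.≟ false) ⟧ * 1
    ≡⟨ one-head b ⟩
  1 ∎
  where
  open ≡-Reasoning
  one-head : ∀ b → ⟦ does (b Bool.≟ true) ⟧ * 1 + ⟦ does (b Bool.≟ false) ⟧ * 1 ≡ 1
  one-head true  = refl
  one-head false = refl
  head-case : ∀ c → Σₗ (δ (b ∷ J)) (map (c ∷_) (allSubsets m)) ≡ ⟦ does (b Bool.≟ c) ⟧ * 1
  head-case c = begin
    Σₗ (δ (b ∷ J)) (map (c ∷_) (allSubsets m))
      ≡⟨ cong ListAction.sum (map-∘ (allSubsets m)) ⟨
    Σₗ (λ I → δ (b ∷ J) (c ∷ I)) (allSubsets m)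
      ≡⟨ Σₗ-cong (λ I → ⟦∧⟧ (does (b Bool.≟ c)) (does (J ≟ˢ I))) (allSubsets m) ⟩
    Σₗ (λ I → ⟦ does (b Bool.≟ c) ⟧ * δ J I) (allSubsets m)
      ≡⟨ Σₗ-*ˡ ⟦ does (b Bool.≟ c) ⟧ (δ J) (allSubsets m) ⟩
    ⟦ does (b Bool.≟ c) ⟧ * Σₗ (δ J) (allSubsets m)
      ≡⟨ cong (⟦ does (b Bool.≟ c) ⟧ *_) (Σδ-allSubsets J) ⟩
    ⟦ does (b Bool.≟ c) ⟧ * 1 ∎

Σδ-filter : ∀ {m} (J : Subset m) (p : Subset m → Bool) xs →
            Σₗ (δ J) (filter (λ I → p I Bool.≟ true) xs) ≡ ⟦ p J ⟧ * Σₗ (δ J) xs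
Σδ-filter J p xs = trans (Σₗ-filter (δ J) p xs) (trans (Σₗ-cong eq xs) (Σₗ-*ˡ ⟦ p J ⟧ (δ J) xs))
  where
  eq : ∀ I → ⟦ p I ⟧ * δ J I ≡ ⟦ p J ⟧ * δ J I
  eq I with J ≟ˢ I
  ... | yes refl = refl
  ... | no  _    = trans (*-zeroʳ ⟦ p I ⟧) (sym (*-zeroʳ ⟦ p J ⟧))

sumℚ-ratio : ∀ {A : Set} (f : A → ℕ) d .⦃ _ : NonZero d ⦄ xs →
             sumℚ (map (λ x → ratio (f x) d) xs) ≡ ratio (Σₗ f xs) d
sumℚ-ratio f d []       = sym (ratio-0 d)
sumℚ-ratio f d (x ∷ xs) = trans (cong (ratio (f x) d ℚ.+_) (sumℚ-ratio f d xs)) (ratio-+ (f x) _ d)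

-- The weight of I is proportional to the number of endomorphisms f with f⁻¹(S) = I,
-- for a fixed maximum independent set S.
module UniformColouring (G : Graph) (ne : Nonempty G) (vt : VertexTransitive G) where
  open HomAveraging (adj G) G vt using (member; member-*; size; size>0; preimages)

  preimage : Fin (n G ^ n G) → Subset (n G)
  preimage x = tabulate (maxIndep G ∘ finToFun x)

  member-indep : ∀ x → member x * ⟦ isIndep G (preimage x) ⟧ ≡ member x
  member-indep x = member-* x λ hom → T⇒⟦⟧≡1 (Equivalence.from (isIndep⇔ G (preimage x))
    (Independent-cong G (λ u → sym (lookup∘tabulate _ u))
      (pullback-indep G G (finToFun x , hom) (maxIndep-indep G))))

  containing : Fin (n G) → List (Subset (n G))
  containing v = filter (λ I → lookup I v Bool.≟ true) (indepSets G)

  mult : Subset (n G) → ℕ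
  mult I = sum (λ x → member x * δ (preimage x) I)

  Σmult : ∀ L → Σₗ mult L ≡ sum (λ x → member x * Σₗ (δ (preimage x)) L)
  Σmult L = trans (Σₗ-sum-comm (λ x I → member x * δ (preimage x) I) L)
    (sum-cong-≗ (λ x → Σₗ-*ˡ (member x) (δ (preimage x)) L))

  Σδ-indepSets : ∀ x → member x * Σₗ (δ (preimage x)) (indepSets G) ≡ member x
  Σδ-indepSets x = trans (cong (member x *_)
    (trans (Σδ-filter (preimage x) (isIndep G) (allSubsets (n G)))
      (trans (cong (⟦ isIndep G (preimage x) ⟧ *_) (Σδ-allSubsets (preimage x))) (*-identityʳ _))))
    (member-indep x)

  Σmult-indepSets : Σₗ mult (indepSets G) ≡ size
  Σmult-indepSets = trans (Σmult (indepSets G)) (sum-cong-≗ Σδ-indepSets)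

  Σmult-containing : ∀ v → Σₗ mult (containing v) ≡
                     sum (λ x → member x * ⟦ maxIndep G (finToFun x v) ⟧)
  Σmult-containing v = trans (Σmult (containing v)) (sum-cong-≗ eq)
    where
    eq : ∀ x → member x * Σₗ (δ (preimage x)) (containing v) ≡
         member x * ⟦ maxIndep G (finToFun x v) ⟧
    eq x = begin
      member x * Σₗ (δ (preimage x)) (containing v)
        ≡⟨ cong (member x *_) (Σδ-filter (preimage x) (λ I → lookup I v) (indepSets G)) ⟩
      member x * (⟦ lookup (preimage x) v ⟧ * Σₗ (δ (preimage x)) (indepSets G))
        ≡⟨ swap (member x) ⟦ lookup (preimage x) v ⟧ _ ⟩
      member x * Σₗ (δ (preimage x)) (indepSets G) * ⟦ lookup (preimage x) v ⟧
        ≡⟨ cong₂ (λ a b → a * ⟦ b ⟧) (Σδ-indepSets x) (lookup∘tabulate _ v) ⟩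
      member x * ⟦ maxIndep G (finToFun x v) ⟧ ∎
      where
      open ≡-Reasoning
      swap : ∀ a b c → a * (b * c) ≡ a * c * b
      swap = solve-∀

  instance
    α≢0 : NonZero (α G)
    α≢0 = >-nonZero (α>0 G ne)
    size≢0 : NonZero size
    size≢0 = >-nonZero (size>0 (proj₂ (idHom G)))
    α*size≢0 : NonZero (α G * size)
    α*size≢0 = m*n≢0 (α G) size

  -- A given vertex lies in the preimage of S for the share `iR G` of the `size` endomorphisms, so
  -- this normalisation covers every vertex with weight exactly 1.
  colouring : Subset (n G) → ℚ
  colouring I = ratio (n G * mult I) (α G * size)

  sum-colouring : ∀ L → sumℚ (map colouring L) ≡ ratio (n G * Σₗ mult L) (α G * size)
  sum-colouring L = trans (sumℚ-ratio (λ I → n G * mult I) (α G * size) L)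
    (cong (λ a → ratio a (α G * size)) (Σₗ-*ˡ (n G) mult L))

  isFracColouring : IsFracColouring G colouring
  isFracColouring = (λ I → 0≤ratio _ (α G * size)) , λ v → ℚP.≤-reflexive (sym (covered v))
    where
    covered : ∀ v → sumℚ (map colouring (containing v)) ≡ 1ℚ
    covered v = trans (sum-colouring (containing v)) (ratio-≡ _ (α G * size) 1 1 (trans (*-identityʳ _) (begin
      n G * Σₗ mult (containing v)
        ≡⟨ cong (n G *_) (Σmult-containing v) ⟩
      n G * sum (λ x → member x * ⟦ maxIndep G (finToFun x v) ⟧)
        ≡⟨ preimages (maxIndep G) v ⟩
      # (maxIndep G) * size
        ≡⟨ cong (_* size) (#maxIndep G) ⟩
      α G * size
        ≡⟨ *-identityˡ _ ⟨
      1 * (α G * size) ∎)))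
      where open ≡-Reasoning

  weight≡ : weight G colouring ≡ ratio (n G) (α G)
  weight≡ = trans (sum-colouring (indepSets G)) (ratio-≡ _ (α G * size) (n G) (α G)
    (trans (cong (λ s → n G * s * α G) Σmult-indepSets) (comm (n G) size (α G))))
    where
    comm : ∀ a b c → a * b * c ≡ a * (c * b)
    comm = solve-∀

ι : ℕ → ℚ
ι a = ratio a 1

ι-+ : ∀ a b → ι (a + b) ≡ ι a ℚ.+ ι b
ι-+ a b = sym (ratio-+ a b 1)

ι-sum : ∀ {m} (f : Fin m → ℕ) → ℚSum.sum (ι ∘ f) ≡ ι (sum f)
ι-sum {zero}  f = refl
ι-sum {suc m} f = trans (cong (ι (f zero) ℚ.+_) (ι-sum (f ∘ suc))) (sym (ι-+ (f zero) _))

ℚsum-mono : ∀ {m} {f g : Fin m → ℚ} → (∀ i → f i ℚ.≤ g i) → ℚSum.sum f ℚ.≤ ℚSum.sum g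
ℚsum-mono {zero}  h = ℚP.≤-refl
ℚsum-mono {suc m} h = ℚP.+-mono-≤ (h zero) (ℚsum-mono (h ∘ suc))

sumℚ-mono : ∀ {A : Set} {f g : A → ℚ} xs → (∀ {x} → x ∈ xs → f x ℚ.≤ g x) → sumℚ (map f xs) ℚ.≤ sumℚ (map g xs)
sumℚ-mono []       h = ℚP.≤-refl
sumℚ-mono (x ∷ xs) h = ℚP.+-mono-≤ (h (here refl)) (sumℚ-mono xs (h ∘ there))

sumℚ-*ˡ : ∀ {A : Set} c (f : A → ℚ) xs → sumℚ (map (λ x → c ℚ.* f x) xs) ≡ c ℚ.* sumℚ (map f xs)
sumℚ-*ˡ c f []       = sym (ℚP.*-zeroʳ c)
sumℚ-*ˡ c f (x ∷ xs) = trans (cong (c ℚ.* f x ℚ.+_) (sumℚ-*ˡ c f xs)) (sym (ℚP.*-distribˡ-+ c (f x) _))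

-- Exchanging the two sums, each set of the list is counted once for each of its vertices.
double-count : ∀ {m} (w : Subset m → ℚ) L →
  ℚSum.sum (λ v → sumℚ (map w (filter (λ I → lookup I v Bool.≟ true) L))) ≡
  sumℚ (map (λ I → ι (card I) ℚ.* w I) L)
double-count {m} w [] = ℚSum.sum-replicate-zero m
double-count {m} w (I ∷ L) = begin
  ℚSum.sum (λ v → covering (I ∷ L) v)
    ≡⟨ ℚSum.sum-cong-≗ step ⟩
  ℚSum.sum (λ v → ι ⟦ lookup I v ⟧ ℚ.* w I ℚ.+ covering L v)
    ≡⟨ ℚSum.∑-distrib-+ (λ v → ι ⟦ lookup I v ⟧ ℚ.* w I) (covering L) ⟩
  ℚSum.sum (λ v → ι ⟦ lookup I v ⟧ ℚ.* w I) ℚ.+ ℚSum.sum (covering L)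
    ≡⟨ cong (ℚ._+ ℚSum.sum (covering L)) (ℚSum.*-distribʳ-sum (w I) (λ v → ι ⟦ lookup I v ⟧)) ⟨
  ℚSum.sum (λ v → ι ⟦ lookup I v ⟧) ℚ.* w I ℚ.+ ℚSum.sum (covering L)
    ≡⟨ cong₂ (λ a b → a ℚ.* w I ℚ.+ b)
         (trans (ι-sum (⟦_⟧ ∘ lookup I)) (cong ι (sym (card≡# (lookup I))))) (double-count w L) ⟩
  ι (card I) ℚ.* w I ℚ.+ sumℚ (map (λ I → ι (card I) ℚ.* w I) L) ∎
  where
  open ≡-Reasoning
  covering : List (Subset m) → Fin m → ℚ
  covering L v = sumℚ (map w (filter (λ I → lookup I v Bool.≟ true) L))
  step : ∀ v → covering (I ∷ L) v ≡ ι ⟦ lookup I v ⟧ ℚ.* w I ℚ.+ covering L v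
  step v with lookup I v
  ... | true  = cong (ℚ._+ covering L v) (sym (ℚP.*-identityˡ (w I)))
  ... | false = sym (trans (cong (ℚ._+ covering L v) (ℚP.*-zeroˡ (w I))) (ℚP.+-identityˡ _))

-- Linear programming duality with the constant vertex weight 1/α: the covering conditions summed
-- over all vertices bound n by the sum of |I| w(I), and each |I| is at most α. Vertex transitivity
-- enters only in the matching colouring.
n/α≤weight : ∀ G → Nonempty G → ∀ w → IsFracColouring G w → ratio (n G) (α G) ℚ.≤ weight G w
n/α≤weight G ne w (w≥0 , covered) = ℚP.*-cancelʳ-≤-pos (ι (α G)) ⦃ ℚ.positive ια>0 ⦄ (begin
  ratio (n G) (α G) ℚ.* ι (α G)
    ≡⟨ ratio-* (n G) (α G) (α G) 1 ⟩
  ratio (n G * α G) (α G * 1)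
    ≡⟨ ratio-≡ (n G * α G) (α G * 1) (n G) 1 ⦃ m*n≢0 (α G) 1 ⦄ (*-assoc (n G) (α G) 1) ⟩
  ι (n G)
    ≡⟨ cong ι (trans (sum-const (n G) 1) (*-identityʳ (n G))) ⟨
  ι (sum {n G} (λ _ → 1))
    ≡⟨ ι-sum {n G} (λ _ → 1) ⟨
  ℚSum.sum {n G} (λ _ → 1ℚ)
    ≤⟨ ℚsum-mono covered ⟩
  ℚSum.sum (λ v → sumℚ (map w (filter (λ I → lookup I v Bool.≟ true) (indepSets G))))
    ≡⟨ double-count w (indepSets G) ⟩
  sumℚ (map (λ I → ι (card I) ℚ.* w I) (indepSets G))
    ≤⟨ sumℚ-mono (indepSets G) (λ {I} I∈ → ℚP.*-monoʳ-≤-nonNeg (w I) ⦃ ℚ.nonNegative (w≥0 I) ⦄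
         (ratio-≤⁺ (card I) 1 (α G) 1 (*-monoˡ-≤ 1 (card≤α G I (∈-indepSets⁻ G {I} I∈))))) ⟩
  sumℚ (map (λ I → ι (α G) ℚ.* w I) (indepSets G))
    ≡⟨ sumℚ-*ˡ (ι (α G)) w (indepSets G) ⟩
  ι (α G) ℚ.* weight G w
    ≡⟨ ℚP.*-comm (ι (α G)) (weight G w) ⟩
  weight G w ℚ.* ι (α G) ∎)
  where
  open ℚP.≤-Reasoning
  instance
    α≢0 : NonZero (α G)
    α≢0 = >-nonZero (α>0 G ne)
  ια>0 : 0ℚ ℚ.< ι (α G)
  ια>0 = ℚP.<-≤-trans (ℚ.*<* (ℤ.+<+ (s≤s z≤n))) (ratio-≤⁺ 1 1 (α G) 1 (*-monoˡ-≤ 1 (α>0 G ne)))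

χf≡n/α : ∀ G → Nonempty G → VertexTransitive G → IsFracChromatic G (ratio (n G) (α G))
χf≡n/α G ne vt = (colouring , isFracColouring , weight≡) , n/α≤weight G ne
  where open UniformColouring G ne vt

IsFracChromatic-unique : ∀ G {r s} → IsFracChromatic G r → IsFracChromatic G s → r ≡ s
IsFracChromatic-unique G ((w , fw , refl) , opt) ((w′ , fw′ , refl) , opt′) =
  ℚP.≤-antisym (opt w′ fw′) (opt′ w fw)

-- Powers of a disjoint union

-- The preimage of a maximum independent set of `H` under the second projection meets each of the
-- `n G` copies of V(H) in `α H` vertices. Thus a further factor never lowers the independence
-- ratio.
α*n≤α⊗ : ∀ G H → n G * α H ≤ α (G ⊗ H)
α*n≤α⊗ G H = ≤-trans (≤-reflexive (sym count))
  (#≤α (G ⊗ H) (pullback-indep (G ⊗ H) H (π₂ G H) (maxIndep-indep H)))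
  where
  count : # (maxIndep H ∘ proj₁ (π₂ G H)) ≡ n G * α H
  count = begin
    # (maxIndep H ∘ proj₁ (π₂ G H))
      ≡⟨ sum-* (n G) {n H} _ ⟩
    sum (λ i → sum (λ j → ⟦ maxIndep H (proj₂ (remQuot {n G} (n H) (combine {n G} {n H} i j))) ⟧))
      ≡⟨ sum-cong-≗ (λ i → sum-cong-≗ (λ j → cong (⟦_⟧ ∘ maxIndep H ∘ proj₂) (remQuot-combine {n G} {n H} i j))) ⟩
    sum {n G} (λ _ → # (maxIndep H))
      ≡⟨ trans (sum-const (n G) _) (cong (n G *_) (#maxIndep H)) ⟩
    n G * α H ∎ where open ≡-Reasoning

-- The hypothesis on sums, for all `f`, says that the images of `i` and `j` together cover every
-- vertex of `X` exactly once. A maximum independent set of `X` pulls back to both parts, so α is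
-- subadditive and n additive, and a common bound a/b on the two ratios passes to `X`.
density-split : ∀ X Y Z (i : Hom Y X) (j : Hom Z X) →
  (∀ f → sum f ≡ sum (f ∘ proj₁ i) + sum (f ∘ proj₁ j)) →
  ∀ a b → α Y * b ≤ a * n Y → α Z * b ≤ a * n Z → α X * b ≤ a * n X
density-split X Y Z i j split a b Y≤ Z≤ = begin
  α X * b               ≤⟨ *-monoˡ-≤ b α≤ ⟩
  (α Y + α Z) * b       ≡⟨ *-distribʳ-+ b (α Y) (α Z) ⟩
  α Y * b + α Z * b     ≤⟨ +-mono-≤ Y≤ Z≤ ⟩
  a * n Y + a * n Z     ≡⟨ *-distribˡ-+ a (n Y) (n Z) ⟨
  a * (n Y + n Z)       ≡⟨ cong (a *_) n≡ ⟨
  a * n X               ∎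
  where
  open ≤-Reasoning
  α≤ : α X ≤ α Y + α Z
  α≤ = subst (_≤ α Y + α Z) (trans (sym (split (⟦_⟧ ∘ maxIndep X))) (#maxIndep X))
    (+-mono-≤ (#≤α Y (pullback-indep Y X i (maxIndep-indep X))) (#≤α Z (pullback-indep Z X j (maxIndep-indep X))))
  sum-1 : ∀ m → sum {m} (λ _ → 1) ≡ m
  sum-1 m = trans (sum-const m 1) (*-identityʳ m)
  n≡ : n X ≡ n Y + n Z
  n≡ = trans (sym (sum-1 (n X))) (trans (split (λ _ → 1)) (cong₂ _+_ (sum-1 (n Y)) (sum-1 (n Z))))

module _ (K A B : Graph) where
  private
    pair : Fin (n K) → Fin (n A + n B) → Fin (n (K ⊗ (A ⊕ B)))
    pair = combine

  inj-⊗ : ∀ {C} → Hom C (A ⊕ B) → Hom (K ⊗ C) (K ⊗ (A ⊕ B))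
  inj-⊗ {C} ι = ⟨_,_⟩ {K ⊗ C} {K} {A ⊕ B} (π₁ K C) (_∘ₕ_ {K ⊗ C} {C} {A ⊕ B} ι (π₂ K C))

  sum-inj-⊗ : ∀ {C} (ι : Hom C (A ⊕ B)) (f : Fin (n (K ⊗ (A ⊕ B))) → ℕ) →
    sum (f ∘ proj₁ (inj-⊗ {C} ι)) ≡ sum (λ k → sum (λ c → f (pair k (proj₁ ι c))))
  sum-inj-⊗ {C} ι f = trans (sum-* (n K) {n C} (f ∘ proj₁ (inj-⊗ {C} ι)))
    (sum-cong-≗ (λ k → sum-cong-≗ (λ c →
      cong (λ (k , c) → f (pair k (proj₁ ι c))) (remQuot-combine {n K} {n C} k c))))

  sum-⊗⊕ : ∀ f → sum f ≡ sum (f ∘ proj₁ (inj-⊗ {A} (ι₁ A B))) + sum (f ∘ proj₁ (inj-⊗ {B} (ι₂ A B)))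
  sum-⊗⊕ f = begin
    sum f
      ≡⟨ sum-* (n K) {n A + n B} f ⟩
    sum (λ k → sum (λ s → f (pair k s)))
      ≡⟨ sum-cong-≗ (λ k → sum-+ (n A) {n B} (λ s → f (pair k s))) ⟩
    sum (λ k → sum (λ a → f (pair k (a ↑ˡ n B))) + sum (λ b → f (pair k (n A ↑ʳ b))))
      ≡⟨ ∑-distrib-+ (λ k → sum (λ a → f (pair k (a ↑ˡ n B)))) (λ k → sum (λ b → f (pair k (n A ↑ʳ b)))) ⟩
    sum (λ k → sum (λ a → f (pair k (a ↑ˡ n B)))) + sum (λ k → sum (λ b → f (pair k (n A ↑ʳ b))))
      ≡⟨ cong₂ _+_ (sum-inj-⊗ {A} (ι₁ A B) f) (sum-inj-⊗ {B} (ι₂ A B) f) ⟨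
    sum (f ∘ proj₁ (inj-⊗ {A} (ι₁ A B))) + sum (f ∘ proj₁ (inj-⊗ {B} (ι₂ A B))) ∎
    where open ≡-Reasoning

module _ (K A B W : Graph) where
  private
    triple : Fin (n K) → Fin (n A + n B) → Fin (n W) → Fin (n (K ⊗ ((A ⊕ B) ⊗ W)))
    triple k s w = combine {n K} {(n A + n B) * n W} k (combine s w)

  -- The regrouping moves the letter `C` from the word into the prefix `K`; what remains is a prefix
  -- times a shorter power, the shape needed by the induction in `density-⊗power`.
  inj-⊗⊗ : ∀ {C} → Hom C (A ⊕ B) → Hom ((K ⊗ C) ⊗ W) (K ⊗ ((A ⊕ B) ⊗ W))
  inj-⊗⊗ {C} ι = ⟨_,_⟩ {X} {K} {(A ⊕ B) ⊗ W} (_∘ₕ_ {X} {K ⊗ C} {K} (π₁ K C) πKC)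
    (⟨_,_⟩ {X} {A ⊕ B} {W} (_∘ₕ_ {X} {C} {A ⊕ B} ι (_∘ₕ_ {X} {K ⊗ C} {C} (π₂ K C) πKC)) (π₂ (K ⊗ C) W))
    where
    X = (K ⊗ C) ⊗ W
    πKC = π₁ (K ⊗ C) W

  sum-inj-⊗⊗ : ∀ {C} (ι : Hom C (A ⊕ B)) (f : Fin (n (K ⊗ ((A ⊕ B) ⊗ W))) → ℕ) →
    sum (f ∘ proj₁ (inj-⊗⊗ {C} ι)) ≡
    sum (λ k → sum (λ c → sum (λ w → f (triple k (proj₁ ι c) w))))
  sum-inj-⊗⊗ {C} ι f = begin
    sum (f ∘ proj₁ (inj-⊗⊗ {C} ι))
      ≡⟨ sum-* (n K * n C) {n W} (f ∘ proj₁ (inj-⊗⊗ {C} ι)) ⟩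
    sum (λ x → sum (λ w → f (proj₁ (inj-⊗⊗ {C} ι) (combine {n K * n C} {n W} x w))))
      ≡⟨ sum-cong-≗ (λ x → sum-cong-≗ (λ w → cong (λ (x , w) → g (remQuot {n K} (n C) x) w)
           (remQuot-combine {n K * n C} {n W} x w))) ⟩
    sum (λ x → sum (λ w → g (remQuot {n K} (n C) x) w))
      ≡⟨ sum-* (n K) {n C} (λ x → sum (λ w → g (remQuot {n K} (n C) x) w)) ⟩
    sum (λ k → sum (λ c → sum (λ w → g (remQuot {n K} (n C) (combine {n K} {n C} k c)) w)))
      ≡⟨ sum-cong-≗ (λ k → sum-cong-≗ (λ c → sum-cong-≗ (λ w → cong (λ kc → g kc w) (remQuot-combine {n K} {n C} k c)))) ⟩
    sum (λ k → sum (λ c → sum (λ w → f (triple k (proj₁ ι c) w)))) ∎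
    where
    open ≡-Reasoning
    g : Fin (n K) × Fin (n C) → Fin (n W) → ℕ
    g (k , c) w = f (triple k (proj₁ ι c) w)

  sum-⊗⊕⊗ : ∀ f → sum f ≡ sum (f ∘ proj₁ (inj-⊗⊗ {A} (ι₁ A B))) + sum (f ∘ proj₁ (inj-⊗⊗ {B} (ι₂ A B)))
  sum-⊗⊕⊗ f = begin
    sum f
      ≡⟨ sum-* (n K) {(n A + n B) * n W} f ⟩
    sum (λ k → sum (λ y → f (combine {n K} {(n A + n B) * n W} k y)))
      ≡⟨ sum-cong-≗ (λ k → sum-* (n A + n B) {n W} (λ y → f (combine {n K} {(n A + n B) * n W} k y))) ⟩
    sum (λ k → sum (λ s → sum (λ w → g k s w)))
      ≡⟨ sum-cong-≗ (λ k → sum-+ (n A) {n B} (λ s → sum (λ w → g k s w))) ⟩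
    sum (λ k → sum (λ a → sum (g k (a ↑ˡ n B))) + sum (λ b → sum (g k (n A ↑ʳ b))))
      ≡⟨ ∑-distrib-+ (λ k → sum (λ a → sum (g k (a ↑ˡ n B)))) (λ k → sum (λ b → sum (g k (n A ↑ʳ b)))) ⟩
    sum (λ k → sum (λ a → sum (g k (a ↑ˡ n B)))) + sum (λ k → sum (λ b → sum (g k (n A ↑ʳ b))))
      ≡⟨ cong₂ _+_ (sum-inj-⊗⊗ {A} (ι₁ A B) f) (sum-inj-⊗⊗ {B} (ι₂ A B) f) ⟨
    sum (f ∘ proj₁ (inj-⊗⊗ {A} (ι₁ A B))) + sum (f ∘ proj₁ (inj-⊗⊗ {B} (ι₂ A B))) ∎
    where
    open ≡-Reasoning
    g : Fin (n K) → Fin (n A + n B) → Fin (n W) → ℕ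
    g k s w = f (triple k s w)

-- `Pointwise` makes adjacent vertices both defined or both undefined, so the domain is a union of
-- components. This is stronger than a homomorphism on the domain, and it allows partial maps to be
-- glued by `_<∣>_`.
PartialHom : (G A : Graph) → (Fin (n G) → Maybe (Fin (n A))) → Set
PartialHom G A p = ∀ u v → T (adj G u v) → Pointwise (λ a b → T (adj A a b)) (p u) (p v)

first : ∀ {A : Set} G k → (Fin (n G) → Maybe A) → Fin (n (power G k)) → Maybe A
first G zero    p x = p x
first G (suc k) p x = let s , r = remQuot {n G} (n (power G k)) x in p s <∣> first G k p r

-- Adjacent words are defined at the same positions, so the first defined letter stands at the same
-- place in both, and the letters there are adjacent.
first-partialHom : ∀ G A k {p} → PartialHom G A p → PartialHom (power G k) A (first G k p)
first-partialHom G A zero    hom = hom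
first-partialHom G A (suc k) {p} hom x y xy =
  combine-Pointwise (hom _ _ (proj₂ (π₁ G (power G k)) x y xy))
    (first-partialHom G A k {p} hom _ _ (proj₂ (π₂ G (power G k)) x y xy))
  where
  combine-Pointwise : ∀ {R : Fin (n A) → Fin (n A) → Set} {a b c d} →
    Pointwise R a b → Pointwise R c d → Pointwise R (a <∣> c) (b <∣> d)
  combine-Pointwise (just r) _ = just r
  combine-Pointwise nothing  q = q

-- A word is undefined exactly when all its letters are; the exponent is `suc k` because `power G k`
-- has that many factors.
#first-nothing : ∀ {A : Set} G k (p : Fin (n G) → Maybe A) →
                 # (is-nothing ∘ first G k p) ≡ # (is-nothing ∘ p) ^ suc k
#first-nothing G zero    p = sym (*-identityʳ _)
#first-nothing G (suc k) p = begin
  # (is-nothing ∘ first G (suc k) p)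
    ≡⟨ sum-* (n G) {n (power G k)} _ ⟩
  sum (λ s → sum (λ r → ⟦ is-nothing (first G (suc k) p (combine {n G} {n (power G k)} s r)) ⟧))
    ≡⟨ sum-cong-≗ (λ s → sum-cong-≗ (λ r → trans
         (cong (λ (s , r) → ⟦ is-nothing (p s <∣> first G k p r) ⟧) (remQuot-combine {n G} {n (power G k)} s r))
         (nothing-<∣> (p s) (first G k p r)))) ⟩
  sum (λ s → sum (λ r → ⟦ is-nothing (p s) ⟧ * ⟦ is-nothing (first G k p r) ⟧))
    ≡⟨ sum-cong-≗ (λ s → *-distribˡ-sum ⟦ is-nothing (p s) ⟧ (⟦_⟧ ∘ is-nothing ∘ first G k p)) ⟨
  sum (λ s → ⟦ is-nothing (p s) ⟧ * # (is-nothing ∘ first G k p))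
    ≡⟨ *-distribʳ-sum (# (is-nothing ∘ first G k p)) (⟦_⟧ ∘ is-nothing ∘ p) ⟨
  # (is-nothing ∘ p) * # (is-nothing ∘ first G k p)
    ≡⟨ cong (# (is-nothing ∘ p) *_) (#first-nothing G k p) ⟩
  # (is-nothing ∘ p) ^ suc (suc k) ∎
  where
  open ≡-Reasoning
  nothing-<∣> : ∀ {A : Set} (a b : Maybe A) → ⟦ is-nothing (a <∣> b) ⟧ ≡ ⟦ is-nothing a ⟧ * ⟦ is-nothing b ⟧
  nothing-<∣> (just _) b = refl
  nothing-<∣> nothing  b = sym (*-identityˡ _)

-- Averaging over maps to A ⊗ B, with weight 1 on the vertices where both p and q are
-- defined and with the edges at the other vertices removed.
density-lower : ∀ X A B p q → VertexTransitive (A ⊗ B) → Nonempty A → Nonempty B →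
  PartialHom X A p → PartialHom X B q →
  α (A ⊗ B) * n X ≤ α X * n (A ⊗ B) + α (A ⊗ B) * (# (is-nothing ∘ p) + # (is-nothing ∘ q))
density-lower X A B p q vt neA neB homp homq = begin
  α (A ⊗ B) * n X
    ≤⟨ *-monoʳ-≤ (α (A ⊗ B)) cover ⟩
  α (A ⊗ B) * (# both + (# (is-nothing ∘ p) + # (is-nothing ∘ q)))
    ≡⟨ *-distribˡ-+ (α (A ⊗ B)) (# both) _ ⟩
  α (A ⊗ B) * # both + α (A ⊗ B) * (# (is-nothing ∘ p) + # (is-nothing ∘ q))
    ≤⟨ +-monoˡ-≤ _ (subst (λ a → a * # both ≤ α X * n (A ⊗ B)) (#maxIndep (A ⊗ B))
         (HomAveraging.averaging R (A ⊗ B) vt (⟦_⟧ ∘ both) (maxIndep (A ⊗ B)) (α X) {φ} φ-hom pull)) ⟩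
  α X * n (A ⊗ B) + α (A ⊗ B) * (# (is-nothing ∘ p) + # (is-nothing ∘ q)) ∎
  where
  open ≤-Reasoning
  both : Fin (n X) → Bool
  both u = is-just (p u) ∧ is-just (q u)
  -- Testing `both` at one endpoint suffices: by `PartialHom` the other endpoint of the edge is then
  -- defined too.
  R : Fin (n X) → Fin (n X) → Bool
  R u v = adj X u v ∧ both u
  cover : n X ≤ # both + (# (is-nothing ∘ p) + # (is-nothing ∘ q))
  cover = begin
    n X                   ≡⟨ trans (sum-const (n X) 1) (*-identityʳ _) ⟨
    sum {n X} (λ _ → 1)   ≤⟨ sum-mono (λ u → pointwise (is-just (p u)) (is-just (q u))) ⟩
    sum (λ u → ⟦ both u ⟧ + (⟦ is-nothing (p u) ⟧ + ⟦ is-nothing (q u) ⟧))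
      ≡⟨ ∑-distrib-+ (⟦_⟧ ∘ both) (λ u → ⟦ is-nothing (p u) ⟧ + ⟦ is-nothing (q u) ⟧) ⟩
    # both + sum (λ u → ⟦ is-nothing (p u) ⟧ + ⟦ is-nothing (q u) ⟧)
      ≡⟨ cong (# both +_) (∑-distrib-+ (⟦_⟧ ∘ is-nothing ∘ p) (⟦_⟧ ∘ is-nothing ∘ q)) ⟩
    # both + (# (is-nothing ∘ p) + # (is-nothing ∘ q)) ∎
    where
    pointwise : ∀ a b → 1 ≤ ⟦ a ∧ b ⟧ + (⟦ not a ⟧ + ⟦ not b ⟧)
    pointwise false b     = s≤s z≤n
    pointwise true  false = s≤s z≤n
    pointwise true  true  = s≤s z≤n
  -- The default vertex is arbitrary, since `R` relates only vertices at which `p` and `q` are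
  -- defined.
  total : ∀ {C} → Nonempty C → Maybe (Fin (n C)) → Fin (n C)
  total {C} ne = fromMaybe (vertex C ne)
  φ : Fin (n X) → Fin (n (A ⊗ B))
  φ u = combine (total {A} neA (p u)) (total {B} neB (q u))
  defined-adj : ∀ {C} (ne : Nonempty C) {a b} → T (is-just a) → Pointwise (λ a b → T (adj C a b)) a b →
                T (adj C (total {C} ne a) (total {C} ne b))
  defined-adj ne _ (just ab) = ab
  φ-hom : IsHom R (A ⊗ B) φ
  φ-hom u v uv =
    let xy , d = Equivalence.to (T-∧ {adj X u v}) uv
        dp , dq = Equivalence.to (T-∧ {is-just (p u)}) d
    in subst T (sym (⊗-adj A B (remQuot-combine {n A} {n B} _ _) (remQuot-combine {n A} {n B} _ _)))
         (Equivalence.from T-∧ (defined-adj {A} neA dp (homp u v xy) , defined-adj {B} neB dq (homq u v xy)))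
  pull : ∀ f → IsHom R (A ⊗ B) f → sum (λ u → ⟦ both u ⟧ * ⟦ maxIndep (A ⊗ B) (f u) ⟧) ≤ α X
  pull f hom = ≤-trans (≤-reflexive (sym (sum-cong-≗ (λ u → ⟦∧⟧ (both u) (maxIndep (A ⊗ B) (f u))))))
    (#≤α X {λ u → both u ∧ maxIndep (A ⊗ B) (f u)} λ u v u∈ v∈ uv →
      let bu , Su = Equivalence.to (T-∧ {both u}) u∈
          bv , Sv = Equivalence.to (T-∧ {both v}) v∈
      in maxIndep-indep (A ⊗ B) (f u) (f v) Su Sv (hom u v (Equivalence.from T-∧ (uv , bu))))

module _ (A B : Graph) where
  onLeft : Fin (n (A ⊕ B)) → Maybe (Fin (n A))
  onLeft x = [ just , (λ _ → nothing) ]′ (splitAt (n A) x)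

  onRight : Fin (n (A ⊕ B)) → Maybe (Fin (n B))
  onRight x = [ (λ _ → nothing) , just ]′ (splitAt (n A) x)

  onLeft-partialHom : PartialHom (A ⊕ B) A onLeft
  onLeft-partialHom x y xy with splitAt (n A) x | splitAt (n A) y
  ... | inj₁ _ | inj₁ _ = just xy
  ... | inj₂ _ | inj₂ _ = nothing

  onRight-partialHom : PartialHom (A ⊕ B) B onRight
  onRight-partialHom x y xy with splitAt (n A) x | splitAt (n A) y
  ... | inj₁ _ | inj₁ _ = nothing
  ... | inj₂ _ | inj₂ _ = just xy

  #onLeft-nothing : # (is-nothing ∘ onLeft) ≡ n B
  #onLeft-nothing = trans (sum-+ (n A) {n B} _) (cong₂ _+_
    (trans (sum-cong-≗ (λ i → cong (⟦_⟧ ∘ is-nothing ∘ [ just , (λ _ → nothing) ]′) (splitAt-↑ˡ (n A) i (n B))))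
      (trans (sum-const (n A) 0) (*-zeroʳ (n A))))
    (trans (sum-cong-≗ (λ j → cong (⟦_⟧ ∘ is-nothing ∘ [ just , (λ _ → nothing) ]′) (splitAt-↑ʳ (n A) (n B) j)))
      (trans (sum-const (n B) 1) (*-identityʳ (n B)))))

  #onRight-nothing : # (is-nothing ∘ onRight) ≡ n A
  #onRight-nothing = trans (trans (sum-+ (n A) {n B} _) (cong₂ _+_
    (trans (sum-cong-≗ (λ i → cong (⟦_⟧ ∘ is-nothing ∘ [ (λ _ → nothing) , just ]′) (splitAt-↑ˡ (n A) i (n B))))
      (trans (sum-const (n A) 1) (*-identityʳ (n A))))
    (trans (sum-cong-≗ (λ j → cong (⟦_⟧ ∘ is-nothing ∘ [ (λ _ → nothing) , just ]′) (splitAt-↑ʳ (n A) (n B) j)))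
      (trans (sum-const (n B) 0) (*-zeroʳ (n B)))))) (+-identityʳ (n A))

-- Bernoulli's inequality for (1 + b/a)^m, multiplied by a^(m+1).
bernoulli : ∀ a b m → a * a ^ m + m * (b * a ^ m) ≤ a * (a + b) ^ m
bernoulli a b zero    = ≤-reflexive (+-identityʳ _)
bernoulli a b (suc m) = begin
  a * (a * a ^ m) + suc m * (b * (a * a ^ m))
    ≡⟨ expand a b m (a ^ m) ⟩
  a * (a * a ^ m + m * (b * a ^ m)) + b * a * a ^ m
    ≤⟨ +-mono-≤ (*-monoʳ-≤ a (bernoulli a b m)) (*-monoʳ-≤ (b * a) (^-monoˡ-≤ m (m≤m+n a b))) ⟩
  a * (a * (a + b) ^ m) + b * a * (a + b) ^ m
    ≡⟨ collect a b ((a + b) ^ m) ⟩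
  a * ((a + b) * (a + b) ^ m) ∎
  where
  open ≤-Reasoning
  expand : ∀ a b m x → a * (a * x) + suc m * (b * (a * x)) ≡ a * (a * x + m * (b * x)) + b * a * x
  expand = solve-∀
  collect : ∀ a b x → a * (a * x) + b * a * x ≡ a * ((a + b) * x)
  collect = solve-∀

m*a^m≤ : ∀ a b m → 0 < b → m * a ^ m ≤ a * (a + b) ^ m
m*a^m≤ a b m b>0 = begin
  m * a ^ m                     ≤⟨ *-monoʳ-≤ m (≤-trans (≤-reflexive (sym (*-identityˡ _))) (*-monoˡ-≤ (a ^ m) b>0)) ⟩
  m * (b * a ^ m)               ≤⟨ m≤n+m _ _ ⟩
  a * a ^ m + m * (b * a ^ m)   ≤⟨ bernoulli a b m ⟩
  a * (a + b) ^ m               ∎ where open ≤-Reasoning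

-- Among the `(a + b) ^ m` vertices of the power, `a ^ m + b ^ m` are words in a single letter;
-- their share is at most (a + b)/m, a slow rate that still tends to 0.
m*[a^m+b^m]≤ : ∀ a b m → 0 < a → 0 < b → m * (a ^ m + b ^ m) ≤ (a + b) * (a + b) ^ m
m*[a^m+b^m]≤ a b m a>0 b>0 = begin
  m * (a ^ m + b ^ m)                     ≡⟨ *-distribˡ-+ m (a ^ m) (b ^ m) ⟩
  m * a ^ m + m * b ^ m                   ≤⟨ +-mono-≤ (m*a^m≤ a b m b>0) (m*a^m≤ b a m a>0) ⟩
  a * (a + b) ^ m + b * (b + a) ^ m       ≡⟨ cong (λ c → a * (a + b) ^ m + b * c ^ m) (+-comm b a) ⟩
  a * (a + b) ^ m + b * (a + b) ^ m       ≡⟨ *-distribʳ-+ ((a + b) ^ m) a b ⟨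
  (a + b) * (a + b) ^ m                   ∎ where open ≤-Reasoning

module _ (A B : Graph) (neA : Nonempty A) (neB : Nonempty B)
         (vtA : VertexTransitive A) (vtB : VertexTransitive B) where

  -- The factor K absorbs the letters of a word of the disjoint union one by one.
  density-⊗power : ∀ k K → VertexTransitive K → Hom (A ⊗ B) K →
    α (K ⊗ power (A ⊕ B) k) * n (A ⊗ B) ≤ α (A ⊗ B) * n (K ⊗ power (A ⊕ B) k)
  density-⊗power zero K vt h =
    density-split (K ⊗ (A ⊕ B)) (K ⊗ A) (K ⊗ B) (inj-⊗ K A B {A} (ι₁ A B)) (inj-⊗ K A B {B} (ι₂ A B))
      (sum-⊗⊕ K A B) (α (A ⊗ B)) (n (A ⊗ B))
      -- Whatever `K` has absorbed, `K ⊗ A` is vertex transitive, and `h` paired with a projection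
      -- maps `A ⊗ B` to it.
      (no-hom (A ⊗ B) (K ⊗ A) (⊗-vertexTransitive K A vt vtA) (⟨_,_⟩ {A ⊗ B} {K} {A} h (π₁ A B)))
      (no-hom (A ⊗ B) (K ⊗ B) (⊗-vertexTransitive K B vt vtB) (⟨_,_⟩ {A ⊗ B} {K} {B} h (π₂ A B)))
  density-⊗power (suc k) K vt h =
    density-split (K ⊗ ((A ⊕ B) ⊗ W)) ((K ⊗ A) ⊗ W) ((K ⊗ B) ⊗ W)
      (inj-⊗⊗ K A B W {A} (ι₁ A B)) (inj-⊗⊗ K A B W {B} (ι₂ A B)) (sum-⊗⊕⊗ K A B W)
      (α (A ⊗ B)) (n (A ⊗ B))
      (density-⊗power k (K ⊗ A) (⊗-vertexTransitive K A vt vtA) (⟨_,_⟩ {A ⊗ B} {K} {A} h (π₁ A B)))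
      (density-⊗power k (K ⊗ B) (⊗-vertexTransitive K B vt vtB) (⟨_,_⟩ {A ⊗ B} {K} {B} h (π₂ A B)))
    where W = power (A ⊕ B) k

  -- The empty word would be a looped vertex, which is not a `Graph`, so the induction starts from
  -- the prefix `A ⊗ B`; afterwards the prefix is dropped by `α*n≤α⊗`.
  density-power≤ : ∀ k → α (power (A ⊕ B) k) * n (A ⊗ B) ≤ α (A ⊗ B) * n (power (A ⊕ B) k)
  density-power≤ k = *-cancelˡ-≤ (n (A ⊗ B)) ⦃ ⊗-nonempty A B neA neB ⦄ (begin
    n (A ⊗ B) * (α W * n (A ⊗ B))     ≡⟨ *-assoc (n (A ⊗ B)) (α W) _ ⟨
    n (A ⊗ B) * α W * n (A ⊗ B)       ≤⟨ *-monoˡ-≤ (n (A ⊗ B)) (α*n≤α⊗ (A ⊗ B) W) ⟩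
    α ((A ⊗ B) ⊗ W) * n (A ⊗ B)       ≤⟨ density-⊗power k (A ⊗ B) (⊗-vertexTransitive A B vtA vtB) (idHom (A ⊗ B)) ⟩
    α (A ⊗ B) * (n (A ⊗ B) * n W)     ≡⟨ swap (α (A ⊗ B)) (n (A ⊗ B)) (n W) ⟩
    n (A ⊗ B) * (α (A ⊗ B) * n W)     ∎)
    where
    open ≤-Reasoning
    W = power (A ⊕ B) k
    swap : ∀ a b c → a * (b * c) ≡ b * (a * c)
    swap = solve-∀

  -- The first left letter and the first right letter of a word give the two partial maps for
  -- `density-lower`; one of them is undefined only on pure words. The claim reads p ≤ i(W) + (n A +
  -- n B)/(k + 1) with denominators cleared.
  ≤density-power : ∀ k → let W = power (A ⊕ B) k in
    α (A ⊗ B) * (n W * suc k) ≤ (α W * suc k + (n A + n B) * n W) * n (A ⊗ B)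
  ≤density-power k = begin
    a * (n W * suc k)
      ≡⟨ *-assoc a (n W) (suc k) ⟨
    a * n W * suc k
      ≤⟨ *-monoˡ-≤ (suc k) lower ⟩
    (α W * h + a * (n B ^ suc k + n A ^ suc k)) * suc k
      ≡⟨ expand (α W) h a (n B ^ suc k) (n A ^ suc k) (suc k) ⟩
    α W * suc k * h + a * (suc k * (n A ^ suc k + n B ^ suc k))
      ≤⟨ +-monoʳ-≤ (α W * suc k * h) (*-mono-≤ (α≤n (A ⊗ B))
           (m*[a^m+b^m]≤ (n A) (n B) (suc k) (>-nonZero⁻¹ (n A) ⦃ neA ⦄) (>-nonZero⁻¹ (n B) ⦃ neB ⦄))) ⟩
    α W * suc k * h + h * ((n A + n B) * (n A + n B) ^ suc k)
      ≡⟨ cong (λ w → α W * suc k * h + h * ((n A + n B) * w)) (power-n (A ⊕ B) k) ⟨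
    α W * suc k * h + h * ((n A + n B) * n W)
      ≡⟨ collect (α W * suc k) h ((n A + n B) * n W) ⟩
    (α W * suc k + (n A + n B) * n W) * h ∎
    where
    open ≤-Reasoning
    W = power (A ⊕ B) k
    a = α (A ⊗ B)
    h = n (A ⊗ B)
    lower : a * n W ≤ α W * h + a * (n B ^ suc k + n A ^ suc k)
    lower = subst₂ (λ x y → a * n W ≤ α W * h + a * (x + y))
      (trans (#first-nothing (A ⊕ B) k (onLeft A B)) (cong (_^ suc k) (#onLeft-nothing A B)))
      (trans (#first-nothing (A ⊕ B) k (onRight A B)) (cong (_^ suc k) (#onRight-nothing A B)))
      (density-lower W A B _ _ (⊗-vertexTransitive A B vtA vtB) neA neB
        (first-partialHom (A ⊕ B) A k {onLeft A B} (onLeft-partialHom A B))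
        (first-partialHom (A ⊕ B) B k {onRight A B} (onRight-partialHom A B)))
    expand : ∀ w h a x y k → (w * h + a * (x + y)) * k ≡ w * k * h + a * (k * (y + x))
    expand = solve-∀
    collect : ∀ w h x → w * h + h * x ≡ (w + x) * h
    collect = solve-∀

-- Limits and the equivalence

iR-antitone : ∀ G H → Nonempty G → Nonempty H → VertexTransitive H → Hom G H → iR H ℚ.≤ iR G
iR-antitone G H neG neH vt h = ratio-≤⁺ (α H) (n H) (α G) (n G) ⦃ neH ⦄ ⦃ neG ⦄ (no-hom G H vt h)

iPow-const : ∀ G → Nonempty G → VertexTransitive G → ∀ k → iPow G k ≡ iR G
iPow-const G ne vt k = ℚP.≤-antisym
  (iR-antitone G (power G k) ne neP (power-vertexTransitive G k vt) (diagonal G k))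
  (iR-antitone (power G k) G neP ne vt (power→ G k))
  where neP = power-nonempty G k ne

ratio⁻¹-antitone : ∀ a b c d .⦃ _ : NonZero a ⦄ .⦃ _ : NonZero b ⦄ .⦃ _ : NonZero c ⦄ .⦃ _ : NonZero d ⦄ →
                   ratio a b ℚ.≤ ratio c d → ratio d c ℚ.≤ ratio b a
ratio⁻¹-antitone a b c d h = ratio-≤⁺ d c b a
  (subst₂ _≤_ (*-comm a d) (*-comm c b) (ratio-≤⁻ a b c d h))

n/α≤⇔iR≤ : ∀ G H → Nonempty G → Nonempty H → (ratio (n G) (α G) ℚ.≤ ratio (n H) (α H)) ⇔ (iR H ℚ.≤ iR G)
n/α≤⇔iR≤ G H neG neH = mk⇔ (ratio⁻¹-antitone (n G) (α G) (n H) (α H)) (ratio⁻¹-antitone (α H) (n H) (α G) (n G))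
  where
  instance
    nG≢0 : NonZero (n G)
    nG≢0 = neG
    nH≢0 : NonZero (n H)
    nH≢0 = neH
    αG≢0 : NonZero (α G)
    αG≢0 = >-nonZero (α>0 G neG)
    αH≢0 : NonZero (α H)
    αH≢0 = >-nonZero (α>0 H neH)

N/[1+k]→0 : ∀ N (ε : ℚ) → 0ℚ ℚ.< ε → ∃ λ K → ∀ k → K ≤ k → ratio N (suc k) ℚ.< ε
N/[1+k]→0 N ε@(ℚ.mkℚ (ℤ.+ zero) d _) (ℚ.*<* (ℤ.+<+ ()))
-- The numerator of ε is at least 1, so ε is at least 1/(d + 1), and N/(k + 1) drops below that once
-- k + 1 exceeds `N * suc d`.
N/[1+k]→0 N ε@(ℚ.mkℚ (ℤ.+ suc p) d _) _ = N * suc d , λ k K≤k →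
  ℚP.<-≤-trans
    (ℚP.≰⇒> λ h → <⇒≱ (s≤s K≤k) (subst (_≤ N * suc d) (*-identityˡ _) (ratio-≤⁻ 1 (suc d) N (suc k) h)))
    (subst (ratio 1 (suc d) ℚ.≤_) (ℚP.↥p/↧p≡p ε) (ratio-≤⁺ 1 (suc d) (suc p) (suc d) (*-monoˡ-≤ (suc d) {1} {suc p} (s≤s z≤n))))
N/[1+k]→0 N (ℚ.mkℚ (ℤ.-[1+ _ ]) d _) (ℚ.*<* ())

p-q+q≡p : ∀ p q → p ℚ.- q ℚ.+ q ≡ p
p-q+q≡p p q = trans (ℚP.+-assoc p (ℚ.- q) q) (trans (cong (p ℚ.+_) (ℚP.+-inverseˡ q)) (ℚP.+-identityʳ p))

p<q⇒0<q-p : ∀ {p q} → p ℚ.< q → 0ℚ ℚ.< q ℚ.- p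
p<q⇒0<q-p {p} {q} p<q = subst (ℚ._< q ℚ.- p) (ℚP.+-inverseʳ p) (ℚP.+-monoˡ-< (ℚ.- p) p<q)

p-r<q-r⇒p<q : ∀ p q r → p ℚ.- r ℚ.< q ℚ.- r → p ℚ.< q
p-r<q-r⇒p<q p q r h = subst₂ ℚ._<_ (p-q+q≡p p r) (p-q+q≡p q r) (ℚP.+-monoˡ-< r h)

p≤∣p∣ : ∀ p → p ℚ.≤ ℚ.∣ p ∣
p≤∣p∣ (ℚ.mkℚ (ℤ.+ _) _ _)     = ℚP.≤-refl
p≤∣p∣ (ℚ.mkℚ (ℤ.-[1+ _ ]) _ _) = ℚ.*≤* ℤ.-≤+

∣p-q∣≡q-p : ∀ {p q} → p ℚ.≤ q → ℚ.∣ p ℚ.- q ∣ ≡ q ℚ.- p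
∣p-q∣≡q-p {p} {q} p≤q = begin
  ℚ.∣ p ℚ.- q ∣          ≡⟨ ℚP.∣-p∣≡∣p∣ (p ℚ.- q) ⟨
  ℚ.∣ ℚ.- (p ℚ.- q) ∣    ≡⟨ cong ℚ.∣_∣ (solve 2 (λ p q → :- (p :- q) := q :- p) refl p q) ⟩
  ℚ.∣ q ℚ.- p ∣          ≡⟨ ℚP.0≤p⇒∣p∣≡p (subst (ℚ._≤ q ℚ.- p) (ℚP.+-inverseʳ p) (ℚP.+-monoˡ-≤ (ℚ.- p) p≤q)) ⟩
  q ℚ.- p                ∎
  where
  open ≡-Reasoning
  open ℚSolver.+-*-Solver

-- The two bounds squeeze `s` to `p` while `t` is constantly `c`, so the limits agree exactly when p
-- = c; given c ≤ p, only p ≤ c is at stake.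
limit⇔ : ∀ (s t : ℕ → ℚ) N {p c} → (∀ k → t k ≡ c) → c ℚ.≤ p →
         (∀ k → s k ℚ.≤ p) → (∀ k → p ℚ.≤ s k ℚ.+ ratio N (suc k)) →
         (p ℚ.≤ c) ⇔ SameLimit s t
limit⇔ s t N {p} {c} t≡c c≤p s≤p p≤s+ = mk⇔ to from
  where
  to : p ℚ.≤ c → SameLimit s t
  to p≤c ε ε>0 with N/[1+k]→0 N ε ε>0
  ... | K , small = K , λ k K≤k → ℚP.≤-<-trans (bound k) (small k K≤k)
    where
    bound : ∀ k → ℚ.∣ s k ℚ.- t k ∣ ℚ.≤ ratio N (suc k)
    bound k rewrite t≡c k | ℚP.≤-antisym c≤p p≤c = begin
      ℚ.∣ s k ℚ.- p ∣                         ≡⟨ ∣p-q∣≡q-p (s≤p k) ⟩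
      p ℚ.- s k                               ≤⟨ ℚP.+-monoˡ-≤ (ℚ.- s k) (p≤s+ k) ⟩
      s k ℚ.+ ratio N (suc k) ℚ.- s k         ≡⟨ solve 2 (λ x y → x :+ y :- x := y) refl (s k) (ratio N (suc k)) ⟩
      ratio N (suc k)                         ∎
      where
      open ℚP.≤-Reasoning
      open ℚSolver.+-*-Solver
  from : SameLimit s t → p ℚ.≤ c
  from lim = ℚP.≮⇒≥ λ c<p → separated c<p (ℚP.<-dense c<p)
    where
    -- For large k the term `s k` would lie below `m`, being close to `c`, and above `m`, being
    -- close to `p`; the tolerances are m - c and p - m.
    separated : c ℚ.< p → ¬ ∃ λ m → c ℚ.< m × m ℚ.< p
    separated c<p (m , c<m , m<p) with lim (m ℚ.- c) (p<q⇒0<q-p c<m) | N/[1+k]→0 N (p ℚ.- m) (p<q⇒0<q-p m<p)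
    ... | K , close | L , small = ℚP.<-asym s<m m<s
      where
      k = K ⊔ L
      s<m : s k ℚ.< m
      s<m = p-r<q-r⇒p<q (s k) m c (ℚP.≤-<-trans (p≤∣p∣ (s k ℚ.- c))
        (subst (λ x → ℚ.∣ s k ℚ.- x ∣ ℚ.< m ℚ.- c) (t≡c k) (close k (m≤m⊔n K L))))
      m<s : m ℚ.< s k
      m<s = subst₂ ℚ._<_ (solve 2 (λ p m → p :+ (m :- p) := m) refl p m)
        (solve 3 (λ s p m → s :+ (p :- m) :+ (m :- p) := s) refl (s k) p m)
        (ℚP.+-monoˡ-< (m ℚ.- p) (ℚP.≤-<-trans (p≤s+ k) (ℚP.+-monoʳ-< (s k) (small k (m≤n⊔m K L)))))
        where open ℚSolver.+-*-Solver

iPow-⊕≤ : ∀ A B → Nonempty A → Nonempty B → VertexTransitive A → VertexTransitive B →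
          ∀ k → iPow (A ⊕ B) k ℚ.≤ iR (A ⊗ B)
iPow-⊕≤ A B neA neB vtA vtB k = ratio-≤⁺ (α (power (A ⊕ B) k)) (n (power (A ⊕ B) k)) (α (A ⊗ B)) (n (A ⊗ B))
  ⦃ power-nonempty (A ⊕ B) k (⊕-nonempty A B neA) ⦄ ⦃ ⊗-nonempty A B neA neB ⦄ (density-power≤ A B neA neB vtA vtB k)

≤iPow-⊕ : ∀ A B → Nonempty A → Nonempty B → VertexTransitive A → VertexTransitive B →
          ∀ k → iR (A ⊗ B) ℚ.≤ iPow (A ⊕ B) k ℚ.+ ratio (n A + n B) (suc k)
≤iPow-⊕ A B neA neB vtA vtB k = ℚP.≤-trans
  (ratio-≤⁺ (α (A ⊗ B)) (n (A ⊗ B)) (α W * suc k + (n A + n B) * n W) (n W * suc k)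
     (≤density-power A B neA neB vtA vtB k))
  (ℚP.≤-reflexive (sym (trans (cong₂ ℚ._+_
     (ratio-≡ (α W) (n W) (α W * suc k) (n W * suc k) (expand (α W) (n W) (suc k)))
     (ratio-≡ (n A + n B) (suc k) ((n A + n B) * n W) (n W * suc k) (sym (*-assoc (n A + n B) (n W) (suc k)))))
     (ratio-+ (α W * suc k) ((n A + n B) * n W) (n W * suc k)))))
  where
  W = power (A ⊕ B) k
  expand : ∀ a b c → a * (b * c) ≡ a * c * b
  expand = solve-∀
  instance
    W≢0 : NonZero (n W)
    W≢0 = power-nonempty (A ⊕ B) k (⊕-nonempty A B neA)
    A⊗B≢0 : NonZero (n (A ⊗ B))
    A⊗B≢0 = ⊗-nonempty A B neA neB
    W*k≢0 : NonZero (n W * suc k)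
    W*k≢0 = m*n≢0 (n W) (suc k)

theorem3p1 : (G₁ G₂ : Graph) → Nonempty G₁ → Nonempty G₂ →
    VertexTransitive G₁ → VertexTransitive G₂ →
    let S1 = iR (G₁ ⊗ G₂) ℚ.≤ (a* G₁ ℚ.⊔ a* G₂)
        S2 = a* (G₁ ⊗ G₂) ℚ.≤ (a* G₁ ℚ.⊔ a* G₂)
        S3 = ∀ (r₁ r₂ r : ℚ) → IsFracChromatic G₁ r₁ → IsFracChromatic G₂ r₂ →
               IsFracChromatic (G₁ ⊗ G₂) r → r ≡ (r₁ ℚ.⊓ r₂)
        S4 = SameLimit (iPow (G₁ ⊕ G₂)) (λ k → iPow G₁ k ℚ.⊔ iPow G₂ k)
    in (S1 ⇔ S2) × (S2 ⇔ S3) × (S3 ⇔ S4)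
theorem3p1 G₁ G₂ ne₁ ne₂ vt₁ vt₂
  -- With `a*` replaced by `iR` on all three graphs, (1) and (2) become the same inequality `D`.
  rewrite a*≡iR G₁ ne₁ vt₁ | a*≡iR G₂ ne₂ vt₂
        | a*≡iR (G₁ ⊗ G₂) (⊗-nonempty G₁ G₂ ne₁ ne₂) (⊗-vertexTransitive G₁ G₂ vt₁ vt₂)
  = mk⇔ id id , D⇔S3 , (D⇔S4 ⇔-∘ ⇔-sym D⇔S3)
  where
  P = G₁ ⊗ G₂
  neP = ⊗-nonempty G₁ G₂ ne₁ ne₂
  vtP = ⊗-vertexTransitive G₁ G₂ vt₁ vt₂
  D = iR P ℚ.≤ iR G₁ ℚ.⊔ iR G₂

  χf : Graph → ℚ
  χf G = ratio (n G) (α G)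

  i₁≤i : iR G₁ ℚ.≤ iR P
  i₁≤i = iR-antitone P G₁ neP ne₁ vt₁ (π₁ G₁ G₂)
  i₂≤i : iR G₂ ℚ.≤ iR P
  i₂≤i = iR-antitone P G₂ neP ne₂ vt₂ (π₂ G₁ G₂)

  -- Reciprocals reverse the order, so `D` bounds `χf P` from below by the minimum; the projections
  -- of `P` give the other inequality. Since `⊔` and `⊓` each select an argument, only comparisons
  -- of two graphs are inverted.
  D⇔χf : D ⇔ (χf P ≡ χf G₁ ℚ.⊓ χf G₂)
  D⇔χf = mk⇔ to from
    where
    to : D → χf P ≡ χf G₁ ℚ.⊓ χf G₂
    to d = ℚP.≤-antisym
      (ℚP.⊓-glb (Equivalence.from (n/α≤⇔iR≤ P G₁ neP ne₁) i₁≤i) (Equivalence.from (n/α≤⇔iR≤ P G₂ neP ne₂) i₂≤i))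
      ([ (λ e → ℚP.≤-trans (ℚP.p⊓q≤p (χf G₁) (χf G₂)) (Equivalence.from (n/α≤⇔iR≤ G₁ P ne₁ neP) (subst (iR P ℚ.≤_) e d)))
       , (λ e → ℚP.≤-trans (ℚP.p⊓q≤q (χf G₁) (χf G₂)) (Equivalence.from (n/α≤⇔iR≤ G₂ P ne₂ neP) (subst (iR P ℚ.≤_) e d)))
       ]′ (ℚP.⊔-sel (iR G₁) (iR G₂)))
    from : χf P ≡ χf G₁ ℚ.⊓ χf G₂ → D
    from e =
      [ (λ m → ℚP.≤-trans (Equivalence.to (n/α≤⇔iR≤ G₁ P ne₁ neP) (ℚP.≤-reflexive (sym (trans e m)))) (ℚP.p≤p⊔q (iR G₁) (iR G₂)))
      , (λ m → ℚP.≤-trans (Equivalence.to (n/α≤⇔iR≤ G₂ P ne₂ neP) (ℚP.≤-reflexive (sym (trans e m)))) (ℚP.p≤q⊔p (iR G₁) (iR G₂)))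
      ]′ (ℚP.⊓-sel (χf G₁) (χf G₂))

  -- (3) speaks of all values that are fractional chromatic numbers: uniqueness transfers the
  -- identity to any such values, and `χf≡n/α` supplies the values at which the converse is read
  -- off.
  D⇔S3 : D ⇔ (∀ (r₁ r₂ r : ℚ) → IsFracChromatic G₁ r₁ → IsFracChromatic G₂ r₂ →
                IsFracChromatic P r → r ≡ (r₁ ℚ.⊓ r₂))
  D⇔S3 = mk⇔
    (λ d r₁ r₂ r f₁ f₂ f → trans (IsFracChromatic-unique P f (χf≡n/α P neP vtP))
      (trans (Equivalence.to D⇔χf d) (cong₂ ℚ._⊓_
        (IsFracChromatic-unique G₁ (χf≡n/α G₁ ne₁ vt₁) f₁)
        (IsFracChromatic-unique G₂ (χf≡n/α G₂ ne₂ vt₂) f₂))))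
    (λ h → Equivalence.from D⇔χf (h _ _ _ (χf≡n/α G₁ ne₁ vt₁) (χf≡n/α G₂ ne₂ vt₂) (χf≡n/α P neP vtP)))

  D⇔S4 : D ⇔ SameLimit (iPow (G₁ ⊕ G₂)) (λ k → iPow G₁ k ℚ.⊔ iPow G₂ k)
  D⇔S4 = limit⇔ (iPow (G₁ ⊕ G₂)) _ (n G₁ + n G₂)
    (λ k → cong₂ ℚ._⊔_ (iPow-const G₁ ne₁ vt₁ k) (iPow-const G₂ ne₂ vt₂ k))
    (ℚP.⊔-lub i₁≤i i₂≤i)
    (iPow-⊕≤ G₁ G₂ ne₁ ne₂ vt₁ vt₂) (≤iPow-⊕ G₁ G₂ ne₁ ne₂ vt₁ vt₂)
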